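{- Let $\mathbf{A} \in \{0,1\}^{d\times n}$ with columns $\mathbf{a}_1,\dots,\mathbf{a}_n$, let $k\ge 1$, and let $(\mathbf{U},\mathbf{V})$, $\mathbf{U}\in\{0,1\}^{d\times k}$, $\mathbf{V}\in\{0,1\}^{k\times n}$, be a fixed optimal solution of $\min_{\mathbf{U},\mathbf{V}}\|\mathbf{A}-\mathbf{U}\mathbf{V}\|_F^2$ over $\mathrm{GF}(2)$, with optimal value $\mathrm{OPT}_k$. Let $\mathbf{b}_1,\dots,\mathbf{b}_k$ be $k$ linearly independent vectors in $\{0,1\}^k = \mathrm{GF}(2)^k$. Then for each $0 \le r \le k$, \[ \mathrm{Err}^{(r)}(\mathbf{b}_1,\dots,\mathbf{b}_{k-r}) \le \mathrm{OPT}_k + \lambda_r \sum_{\mathbf{c} \in \mathrm{span}^c(\mathbf{b}_1,\dots,\mathbf{b}_{k-r})} L_{\mathbf{c}} + \sum_{i=1}^{k-r} f_i(\mathbf{b}_1,\dots,\mathbf{b}_{k-r})\, M_{\mathbf{b}_i}, \] where $\lambda_0 = 0$, $\lambda_r = \frac{r}{2}\left(1 + \frac{1}{2^r-1}\right)$ for $1 \le r \le k$, and \[ f_i(\mathbf{b}_1,\dots,\mathbf{b}_{k-r}) = N_{\mathcal{X}_i} + \tfrac{1}{2} N_{\mathcal{Y}},\quad \mathcal{X}_i = \mathbf{b}_i + \mathrm{span}^{\backslash i}(\mathbf{b}_1,\dots,\mathbf{b}_{k-r}),\quad \mathcal{Y} = \mathrm{span}^c(\mathbf{b}_1,\dots,\mathbf{b}_{k-r}).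 \]
   Context: All vector/matrix arithmetic is over $\mathrm{GF}(2)$; for a binary vector or matrix, $|\cdot|$ and $\|\cdot\|_F^2$ denote the number of entries equal to $1$ (Hamming weight). Spans: for vectors $\mathbf{b}_1,\dots,\mathbf{b}_s \in \{0,1\}^k$, $\mathrm{span}$ is the $\mathrm{GF}(2)$-linear span (the span of no vectors is $\{\mathbf{0}\}$); $\mathrm{span}^c(\mathbf{b}_1,\dots,\mathbf{b}_s) := \{0,1\}^k \setminus \mathrm{span}(\mathbf{b}_1,\dots,\mathbf{b}_s)$; $\mathrm{span}^{\backslash i}(\mathbf{b}_1,\dots,\mathbf{b}_s) := \mathrm{span}(\mathbf{b}_1,\dots,\mathbf{b}_{i-1},\mathbf{b}_{i+1},\dots,\mathbf{b}_s)$. Nearest neighbors: for $\mathbf{u} \in \{0,1\}^d$, $\mathbf{a}_{(\mathbf{u})}$ is a column of $\mathbf{A}$ minimizing $|\mathbf{a}_j - \mathbf{u}|$ (ties broken arbitrarily but fixed). Quantities depending on the fixed $(\mathbf{U},\mathbf{V})$: for $\mathbf{c}\in\{0,1\}^k$, $\mathcal{J}_{\mathbf{c}} := \{j \in [n] : \text{the } j\text{th column of } \mathbf{V} \text{ equals } \mathbf{c}\}$, $n_{\mathbf{c}} := |\mathcal{J}_{\mathbf{c}}|$, $L_{\mathbf{c}} := \sum_{j\in\mathcal{J}_{\mathbf{c}}} |\mathbf{a}_j - \mathbf{U}\mathbf{c}|$, $M_{\mathbf{c}} := L_{\mathbf{c}}/n_{\mathbf{c}}$ if $n_{\mathbf{c}}>0$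 and $M_{\mathbf{c}} := d$ if $n_{\mathbf{c}}=0$; for $\mathcal{X}\subseteq\{0,1\}^k$, $N_{\mathcal{X}} := \sum_{\mathbf{c}\in\mathcal{X}} n_{\mathbf{c}}$. Errors: for any $\mathbf{b}_1,\dots,\mathbf{b}_k \in \{0,1\}^k$, let $\mathbf{B} = (\mathbf{b}_1,\dots,\mathbf{b}_k)$, $\mathbf{A}_{(\mathbf{U}\mathbf{B})} := (\mathbf{a}_{(\mathbf{U}\mathbf{b}_1)},\dots,\mathbf{a}_{(\mathbf{U}\mathbf{b}_k)}) \in \{0,1\}^{d\times k}$, and $\mathrm{Err}(\mathbf{b}_1,\dots,\mathbf{b}_k) := \min_{\mathbf{Q}\in\{0,1\}^{k\times n}} \|\mathbf{A} - \mathbf{A}_{(\mathbf{U}\mathbf{B})}\mathbf{Q}\|_F^2$. Define recursively $\mathrm{Err}^{(0)} := \mathrm{Err}$ and, for $1\le r\le k$, $\mathrm{Err}^{(r)}(\mathbf{b}_1,\dots,\mathbf{b}_{k-r}) := \min_{\mathbf{b}\in\{0,1\}^k} \mathrm{Err}^{(r-1)}(\mathbf{b}_1,\dots,\mathbf{b}_{k-r},\mathbf{b})$ (for $r=k$ this is a number with no arguments). -}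

module Defs where

open import Data.Bool using (Bool; true; false; _∧_; _xor_; if_then_else_; not)
open import Data.Nat using (ℕ; zero; suc; _+_; _∸_; _^_; _≤_; _<_; _⊓_; NonZero; >-nonZero; z≤n)
open import Data.Nat.Properties using (m^n>0; +-mono-≤; m<n⇒0<n∸m)
open import Data.Fin using (Fin; zero; suc; punchIn)
open import Data.List using (List; []; _∷_; map; foldr; concatMap; allFin)
open import Data.Nat.ListAction using (sum)
open import Data.Bool.ListAction using (any; all)
open import Data.Integer using (+_)
open import Data.Rational using (ℚ; _/_; 0ℚ; 1ℚ; ½) renaming (_+_ to _+ℚ_; _*_ to _*ℚ_)

-- Binary vectors / matrices (entries in GF(2) = Bool, xor = +, ∧ = ·)

Bits : ℕ → Set
Bits m = Fin m → Bool

Mat : ℕ → ℕ → Set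
Mat p q = Fin p → Fin q → Bool

col : ∀ {p q} → Mat p q → Fin q → Bits p
col M j i = M i j

_∷ᶠ_ : ∀ {A : Set} {m} → A → (Fin m → A) → Fin (suc m) → A
(x ∷ᶠ f) zero = x
(x ∷ᶠ f) (suc i) = f i

allFuns : ∀ {A : Set} → List A → (m : ℕ) → List (Fin m → A)
allFuns xs zero = (λ ()) ∷ []
allFuns xs (suc m) = concatMap (λ x → map (x ∷ᶠ_) (allFuns xs m)) xs

allBits : (m : ℕ) → List (Bits m)
allBits m = allFuns (true ∷ false ∷ []) m

allMats : (p q : ℕ) → List (Mat p q)
allMats p q = allFuns (allBits q) p

zeroBits : ∀ {m} → Bits m
zeroBits _ = false

zeroMat : ∀ {p q} → Mat p q
zeroMat _ _ = false

minL : ∀ {A : Set} → (A → ℕ) → A → List A → ℕ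
minL f x0 xs = foldr (λ y acc → f y ⊓ acc) (f x0) xs

snoc : ∀ {A : Set} {m} → (Fin m → A) → A → Fin (suc m) → A
snoc {m = zero} f x zero = x
snoc {m = suc m} f x zero = f zero
snoc {m = suc m} f x (suc i) = snoc (λ j → f (suc j)) x i

b2n : Bool → ℕ
b2n true = 1
b2n false = 0

sumL : ∀ {A : Set} → (A → ℕ) → List A → ℕ
sumL f xs = sum (map f xs)

sumFin : (m : ℕ) → (Fin m → ℕ) → ℕ
sumFin m f = sumL f (allFin m)

sumFinℚ : (m : ℕ) → (Fin m → ℚ) → ℚ
sumFinℚ m f = foldr (λ i acc → f i +ℚ acc) 0ℚ (allFin m)

wt : ∀ {m} → Bits m → ℕ
wt {m} v = sumFin m (λ i → b2n (v i))

-- ‖M‖_F^2 = number of ones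
wtM : ∀ {p q} → Mat p q → ℕ
wtM {p} M = sumFin p (λ i → wt (M i))

xorSum : (m : ℕ) → (Fin m → Bool) → Bool
xorSum m f = foldr (λ i acc → f i xor acc) false (allFin m)

_⊕_ : ∀ {m} → Bits m → Bits m → Bits m
(u ⊕ v) i = u i xor v i

_⊕M_ : ∀ {p q} → Mat p q → Mat p q → Mat p q
(M ⊕M N) i j = M i j xor N i j

_·_ : ∀ {p m q} → Mat p m → Mat m q → Mat p q
_·_ {m = m} M N i j = xorSum m (λ l → M i l ∧ N l j)

_·v_ : ∀ {p m} → Mat p m → Bits m → Bits p
_·v_ {m = m} M c i = xorSum m (λ l → M i l ∧ c l)

lincomb : ∀ {s k} → (Fin s → Bits k) → Bits s → Bits k
lincomb {s} bs x t = xorSum s (λ l → x l ∧ bs l t)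

eqBits : ∀ {m} → Bits m → Bits m → Bool
eqBits {m} u v = all (λ i → not (u i xor v i)) (allFin m)

LinIndep : ∀ {s k} → (Fin s → Bits k) → Set
LinIndep {s} {k} bs = (x : Bits s) → (∀ t → lincomb bs x t ≡ false) → ∀ i → x i ≡ false
  where open import Relation.Binary.PropositionalEquality using (_≡_)

inSpan : ∀ {s k} → (Fin s → Bits k) → Bits k → Bool
inSpan {s} bs c = any (λ x → eqBits (lincomb bs x) c) (allBits s)

inSpanWithout : ∀ {s k} → (Fin s → Bits k) → Fin s → Bits k → Bool
inSpanWithout {suc s} bs i c = inSpan (λ j → bs (punchIn i j)) c

toℚ : ℕ → ℚ
toℚ n = + n / 1

2^r-1-nonZero : ∀ r → NonZero (2 ^ suc r ∸ 1)
2^r-1-nonZero r = >-nonZero (m<n⇒0<n∸m (+-mono-≤ p (+-mono-≤ p z≤n)))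
  where p : 1 ≤ 2 ^ r
        p = m^n>0 2 r

lam : ℕ → ℚ
lam zero = 0ℚ
lam (suc r) = (+ suc r / 2) *ℚ (1ℚ +ℚ _/_ (+ 1) (2 ^ suc r ∸ 1) {{2^r-1-nonZero r}})

module Setup (d n k : ℕ) (A : Mat d n) (U : Mat d k) (V : Mat k n)
             (nn : Bits d → Fin n) where

  a : Fin n → Bits d
  a = col A

  nc : Bits k → ℕ
  nc c = sumFin n (λ j → b2n (eqBits (col V j) c))

  Lc : Bits k → ℕ
  Lc c = sumFin n (λ j → if eqBits (col V j) c then wt (a j ⊕ (U ·v c)) else 0)

  ratioOr-d : ℕ → ℕ → ℚ
  ratioOr-d L zero = toℚ d
  ratioOr-d L (suc m) = + L / suc m

  -- M_c = L_c / n_c  (or d if n_c = 0)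
  Mc : Bits k → ℚ
  Mc c = ratioOr-d (Lc c) (nc c)

  NX : (Bits k → Bool) → ℕ
  NX X = sumL (λ c → if X c then nc c else 0) (allBits k)

  -- A_(UB) for B = (b_1,…,b_m): column l is a_(U b_l)
  AUB : ∀ {m} → (Fin m → Bits k) → Mat d m
  AUB bs i l = a (nn (U ·v bs l)) i

  Err : ∀ {m} → (Fin m → Bits k) → ℕ
  Err {m} bs = minL (λ Q → wtM (A ⊕M (AUB bs · Q))) zeroMat (allMats m n)

  ErrR : (r : ℕ) → ∀ {m} → (Fin m → Bits k) → ℕ
  ErrR zero bs = Err bs
  ErrR (suc r) bs = minL (λ b → ErrR r (snoc bs b)) zeroBits (allBits k)

  OPT : ℕ
  OPT = wtM (A ⊕M (U · V))

  sumLcOutside : ∀ {s} → (Fin s → Bits k) → ℕ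
  sumLcOutside bs = sumL (λ c → if not (inSpan bs c) then Lc c else 0) (allBits k)

  f : ∀ {s} → (Fin s → Bits k) → Fin s → ℚ
  f bs i = toℚ (NX (λ c → inSpanWithout bs i (c ⊕ bs i)))
           +ℚ ½ *ℚ toℚ (NX (λ c → not (inSpan bs c)))

  RHS : ∀ {s} → (r : ℕ) → (Fin s → Bits k) → ℚ
  RHS {s} r bs = toℚ OPT +ℚ lam r *ℚ toℚ (sumLcOutside bs)
                 +ℚ sumFinℚ s (λ i → f bs i *ℚ Mc (bs i))

-- Write c_j for the j-th column of V. If every c_j is a combination Σ_l x_jl b_l, taking Q = (x_jl)
-- and the triangle inequality give Err(b) ≤ OPT + Σ_j Σ_l x_jl |a_(U b_l) − U b_l|.
--
-- The bound is proved for any b_1, …, b_m given together with a linear surjection π onto GF(2)^r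
-- whose kernel is their span, by induction on r and with the denominator of λ_r = Λ_r / D_r cleared:
--   2 D_r Err^(r) ≤ 2 D_r (OPT + S) + D_r N_Y E + 2 Λ_r L_Y,
-- where S charges each kernel column the nearest-neighbour distances of its coordinates, E sums these
-- distances over the b_i, and N_Y, L_Y count and weigh the columns outside the kernel. In the step,
-- the adjoined vector is a column outside the kernel, and adjoining it eliminates one coordinate of π.
-- A cheap enough column exists: otherwise, summing the failures over each nonzero coset of ker π and
-- bounding the coordinate disagreements of the pairs inside a coset by AM–GM gives one polynomial
-- inequality per coset, and their sum is contradictory. Dividing by 2 D_r and bounding each
-- nearest-neighbour distance |a_(U b) − U b| by the average M_b gives the theorem.

module Submission where

open import Defs
open import Data.Nat using (ℕ; _≤_; _∸_)
open import Data.Nat.Properties using (m∸n≤m)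
open import Data.Fin using (Fin; inject≤)
open import Data.Rational using () renaming (_≤_ to _≤ℚ_)

open import Relation.Binary.PropositionalEquality
open import Data.Product using (∃; _×_; _,_; proj₁; proj₂)
open import Data.Sum using (_⊎_; inj₁; inj₂; [_,_]′)
open import Data.Empty using (⊥; ⊥-elim)
open import Relation.Nullary using (¬_; yes; no)
import Data.Nat as ℕ

-- Semiring expressions over ℕ, evaluated in ℕ, ℤ and ℚ to move (in)equalities along the casts.
infixl 6 _⊞_
infixl 7 _⊠_
data Expr : Set where
  ‵_ : ℕ → Expr
  _⊞_ _⊠_ : Expr → Expr → Expr

⟦_⟧ℕ : Expr → ℕ
⟦ ‵ n ⟧ℕ = n
⟦ a ⊞ b ⟧ℕ = ⟦ a ⟧ℕ ℕ.+ ⟦ b ⟧ℕ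
⟦ a ⊠ b ⟧ℕ = ⟦ a ⟧ℕ ℕ.* ⟦ b ⟧ℕ

module IntegerInequality where

  open import Data.Nat using (z≤n; s≤s)
  open import Data.Integer using (ℤ; +_; -[1+_]; 0ℤ; 1ℤ; _+_; _*_; -_; _-_; +≤+) renaming (_≤_ to _≤ℤ_)
  open import Data.Integer.Properties using (i≤j⇒0≤j-i; 0≤i-j⇒j≤i; pos-+; pos-*)
  open import Data.Integer.Solver using (module +-*-Solver)
  open +-*-Solver

  NonNeg : ℤ → Set
  NonNeg x = 0ℤ ≤ℤ x

  nonNeg-+ : ∀ {x y} → NonNeg x → NonNeg y → NonNeg (x + y)
  nonNeg-+ (+≤+ z≤n) (+≤+ z≤n) = +≤+ z≤n

  nonNeg-* : ∀ {x y} → NonNeg x → NonNeg y → NonNeg (x * y)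
  nonNeg-* {+ m} {+ n} (+≤+ z≤n) (+≤+ z≤n) = subst NonNeg (pos-* m n) (+≤+ z≤n)

  nonNeg-ℕ : ∀ n → NonNeg (+ n)
  nonNeg-ℕ n = +≤+ z≤n

  ¬nonNeg-1 : ¬ NonNeg (- 1ℤ)
  ¬nonNeg-1 ()

  nonNeg⊎negative : ∀ a → NonNeg a ⊎ NonNeg (- a - 1ℤ)
  nonNeg⊎negative (+ n) = inj₁ (+≤+ z≤n)
  nonNeg⊎negative -[1+ n ] = inj₂ (+≤+ z≤n)

  nonPositive⊎positive : ∀ a → NonNeg (- a) ⊎ NonNeg (a - 1ℤ)
  nonPositive⊎positive (+ 0) = inj₁ (+≤+ z≤n)
  nonPositive⊎positive (+ ℕ.suc n) = inj₂ (+≤+ z≤n)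
  nonPositive⊎positive -[1+ n ] = inj₁ (+≤+ z≤n)

  nonNeg-square : ∀ x → NonNeg (x * x)
  nonNeg-square x with nonNeg⊎negative x
  ... | inj₁ h = nonNeg-* h h
  ... | inj₂ h = subst NonNeg square (nonNeg-+ (nonNeg-+ (nonNeg-* h h) (nonNeg-* (nonNeg-ℕ 2) h)) (nonNeg-ℕ 1))
    where
      square : (- x - 1ℤ) * (- x - 1ℤ) + + 2 * (- x - 1ℤ) + 1ℤ ≡ x * x
      square = solve 1 (λ x → (:- x :- con 1ℤ) :* (:- x :- con 1ℤ) :+ con (+ 2) :* (:- x :- con 1ℤ) :+ con 1ℤ := x :* x) refl x

  nonNeg-cancelˡ : ∀ a z → NonNeg (a - 1ℤ) → NonNeg (a * z) → NonNeg z
  nonNeg-cancelˡ a z a≥1 az≥0 with nonNeg⊎negative z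
  ... | inj₁ z≥0 = z≥0
  ... | inj₂ z<0 = ⊥-elim (¬nonNeg-1 (subst NonNeg identity
          (nonNeg-+ (nonNeg-+ (nonNeg-* a≥1 z<0) az≥0) (nonNeg-+ z<0 a≥1))))
    where
      identity : (a - 1ℤ) * (- z - 1ℤ) + a * z + ((- z - 1ℤ) + (a - 1ℤ)) ≡ - 1ℤ
      identity = solve 2 (λ a z → (a :- con 1ℤ) :* (:- z :- con 1ℤ) :+ a :* z :+ ((:- z :- con 1ℤ) :+ (a :- con 1ℤ)) := :- con 1ℤ) refl a z

  nonNeg-*-1⇒≥1 : ∀ x α y → NonNeg x → NonNeg y → NonNeg (x * α - y - 1ℤ) → NonNeg (α - 1ℤ)
  nonNeg-*-1⇒≥1 x α y x≥0 y≥0 h with nonPositive⊎positive α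
  ... | inj₂ α≥1 = α≥1
  ... | inj₁ α≤0 = ⊥-elim (¬nonNeg-1 (subst NonNeg identity (nonNeg-+ (nonNeg-+ h (nonNeg-* x≥0 α≤0)) y≥0)))
    where
      identity : x * α - y - 1ℤ + x * (- α) + y ≡ - 1ℤ
      identity = solve 3 (λ x α y → x :* α :- y :- con 1ℤ :+ x :* (:- α) :+ y := :- con 1ℤ) refl x α y

  module KeyInequality (D M b N L N′ L′ : ℤ) where

    κ NY LY α X : ℤ
    κ = D * M - b
    NY = N + N′
    LY = L + L′
    α = D * NY - b * N
    X = M * NY * κ * L + LY * b * NY - LY * D * (M * M) * N

    hypothesis conclusion : ℤ
    hypothesis = M * (+ 2 * D * N * L + D * N′ * L + (D + b) * N * L′) - (N * (M * (D + b) + κ) * LY + N)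
    conclusion = D * (M * NY * κ * L + LY * b * NY) - (D * LY * D * (M * M) * N + κ * N)

    hypothesis≡ : hypothesis ≡ M * L * α - (κ * N * LY + (N - 1ℤ)) - 1ℤ
    hypothesis≡ = solve 7 (λ D M b N L N′ L′ →
      M :* (con (+ 2) :* D :* N :* L :+ D :* N′ :* L :+ (D :+ b) :* N :* L′) :- (N :* (M :* (D :+ b) :+ (D :* M :- b)) :* (L :+ L′) :+ N)
      := M :* L :* (D :* (N :+ N′) :- b :* N) :- ((D :* M :- b) :* N :* (L :+ L′) :+ (N :- con 1ℤ)) :- con 1ℤ) refl D M b N L N′ L′

    αX-identity : NY * κ * hypothesis + LY * b * D * ((NY - M * N) * (NY - M * N)) ≡ α * X - NY * κ * N
    αX-identity = solve 7 (λ D M b N L N′ L′ →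
      (N :+ N′) :* (D :* M :- b) :* (M :* (con (+ 2) :* D :* N :* L :+ D :* N′ :* L :+ (D :+ b) :* N :* L′)
          :- (N :* (M :* (D :+ b) :+ (D :* M :- b)) :* (L :+ L′) :+ N))
        :+ (L :+ L′) :* b :* D :* (((N :+ N′) :- M :* N) :* ((N :+ N′) :- M :* N))
      := (D :* (N :+ N′) :- b :* N) :* (M :* (N :+ N′) :* (D :* M :- b) :* L :+ (L :+ L′) :* b :* (N :+ N′) :- (L :+ L′) :* D :* (M :* M) :* N)
           :- (N :+ N′) :* (D :* M :- b) :* N) refl D M b N L N′ L′

    NY-identity : α * X - NY * κ * N + b * N * X ≡ NY * conclusion
    NY-identity = solve 7 (λ D M b N L N′ L′ →
      (D :* (N :+ N′) :- b :* N) :* (M :* (N :+ N′) :* (D :* M :- b) :* L :+ (L :+ L′) :* b :* (N :+ N′) :- (L :+ L′) :* D :* (M :* M) :* N)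
        :- (N :+ N′) :* (D :* M :- b) :* N
        :+ b :* N :* (M :* (N :+ N′) :* (D :* M :- b) :* L :+ (L :+ L′) :* b :* (N :+ N′) :- (L :+ L′) :* D :* (M :* M) :* N)
      := (N :+ N′) :* (D :* (M :* (N :+ N′) :* (D :* M :- b) :* L :+ (L :+ L′) :* b :* (N :+ N′))
                       :- (D :* (L :+ L′) :* D :* (M :* M) :* N :+ (D :* M :- b) :* N))) refl D M b N L N′ L′

    -- The hypothesis gives α ≥ 1, and α X exceeds NY κ N by a nonnegative combination of the hypothesis
    -- and a square; cancelling α gives X ≥ 0, and then NY · conclusion = α X − NY κ N + b N X ≥ 0.
    polynomial-inequalityℤ : NonNeg D → NonNeg M → NonNeg b → NonNeg κ → NonNeg (N - 1ℤ) → NonNeg L → NonNeg N′ → NonNeg L′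
      → NonNeg hypothesis → NonNeg conclusion
    polynomial-inequalityℤ D≥0 M≥0 b≥0 κ≥0 N≥1 L≥0 N′≥0 L′≥0 hyp =
      nonNeg-cancelˡ NY conclusion NY≥1 (subst NonNeg NY-identity (nonNeg-+ αX≥NYκN (nonNeg-* (nonNeg-* b≥0 N≥0) X≥0)))
      where
        N≥0 : NonNeg N
        N≥0 = subst NonNeg (solve 1 (λ N → N :- con 1ℤ :+ con 1ℤ := N) refl N) (nonNeg-+ N≥1 (nonNeg-ℕ 1))
        NY≥1 : NonNeg (NY - 1ℤ)
        NY≥1 = subst NonNeg (solve 2 (λ N N′ → N :- con 1ℤ :+ N′ := N :+ N′ :- con 1ℤ) refl N N′) (nonNeg-+ N≥1 N′≥0)
        LY≥0 : NonNeg LY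
        LY≥0 = nonNeg-+ L≥0 L′≥0
        α≥1 : NonNeg (α - 1ℤ)
        α≥1 = nonNeg-*-1⇒≥1 (M * L) α (κ * N * LY + (N - 1ℤ)) (nonNeg-* M≥0 L≥0) (nonNeg-+ (nonNeg-* (nonNeg-* κ≥0 N≥0) LY≥0) N≥1)
                (subst NonNeg hypothesis≡ hyp)
        αX≥NYκN : NonNeg (α * X - NY * κ * N)
        αX≥NYκN = subst NonNeg αX-identity
          (nonNeg-+ (nonNeg-* (nonNeg-* (nonNeg-+ N≥0 N′≥0) κ≥0) hyp) (nonNeg-* (nonNeg-* (nonNeg-* LY≥0 b≥0) D≥0) (nonNeg-square (NY - M * N))))
        X≥0 : NonNeg X
        X≥0 = nonNeg-cancelˡ α X α≥1 (subst NonNeg (solve 2 (λ αX c → αX :- c :+ c := αX) refl (α * X) (NY * κ * N))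
                (nonNeg-+ αX≥NYκN (nonNeg-* (nonNeg-* (nonNeg-+ N≥0 N′≥0) κ≥0) N≥0)))

  ⟦_⟧ℤ : Expr → ℤ
  ⟦ ‵ n ⟧ℤ = + n
  ⟦ a ⊞ b ⟧ℤ = ⟦ a ⟧ℤ + ⟦ b ⟧ℤ
  ⟦ a ⊠ b ⟧ℤ = ⟦ a ⟧ℤ * ⟦ b ⟧ℤ

  ⟦⟧ℤ-homo : ∀ e → + ⟦ e ⟧ℕ ≡ ⟦ e ⟧ℤ
  ⟦⟧ℤ-homo (‵ n) = refl
  ⟦⟧ℤ-homo (a ⊞ b) = trans (pos-+ ⟦ a ⟧ℕ ⟦ b ⟧ℕ) (cong₂ _+_ (⟦⟧ℤ-homo a) (⟦⟧ℤ-homo b))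
  ⟦⟧ℤ-homo (a ⊠ b) = trans (pos-* ⟦ a ⟧ℕ ⟦ b ⟧ℕ) (cong₂ _*_ (⟦⟧ℤ-homo a) (⟦⟧ℤ-homo b))

  polynomial-inequality : ∀ (D M b κ N L N′ L′ : ℕ) → κ ℕ.+ b ≡ D ℕ.* M → 1 ℕ.≤ N
    → N ℕ.* (M ℕ.* (D ℕ.+ b) ℕ.+ κ) ℕ.* (L ℕ.+ L′) ℕ.+ N ℕ.≤ M ℕ.* (2 ℕ.* D ℕ.* N ℕ.* L ℕ.+ D ℕ.* N′ ℕ.* L ℕ.+ (D ℕ.+ b) ℕ.* N ℕ.* L′)
    → D ℕ.* (L ℕ.+ L′) ℕ.* D ℕ.* (M ℕ.* M) ℕ.* N ℕ.+ κ ℕ.* N ℕ.≤ D ℕ.* (M ℕ.* (N ℕ.+ N′) ℕ.* κ ℕ.* L ℕ.+ (L ℕ.+ L′) ℕ.* b ℕ.* (N ℕ.+ N′))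
  polynomial-inequality D M b κ N@(ℕ.suc _) L N′ L′ κ+b≡DM (s≤s z≤n) hyp = fromℤ eG fG goalℤ
    where
      eF = ‵ N ⊠ (‵ M ⊠ (‵ D ⊞ ‵ b) ⊞ ‵ κ) ⊠ (‵ L ⊞ ‵ L′) ⊞ ‵ N
      fF = ‵ M ⊠ (‵ 2 ⊠ ‵ D ⊠ ‵ N ⊠ ‵ L ⊞ ‵ D ⊠ ‵ N′ ⊠ ‵ L ⊞ (‵ D ⊞ ‵ b) ⊠ ‵ N ⊠ ‵ L′)
      eG = ‵ D ⊠ (‵ L ⊞ ‵ L′) ⊠ ‵ D ⊠ (‵ M ⊠ ‵ M) ⊠ ‵ N ⊞ ‵ κ ⊠ ‵ N
      fG = ‵ D ⊠ (‵ M ⊠ (‵ N ⊞ ‵ N′) ⊠ ‵ κ ⊠ ‵ L ⊞ (‵ L ⊞ ‵ L′) ⊠ ‵ b ⊠ (‵ N ⊞ ‵ N′))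
      toℤ : ∀ e f → ⟦ e ⟧ℕ ℕ.≤ ⟦ f ⟧ℕ → ⟦ e ⟧ℤ ≤ℤ ⟦ f ⟧ℤ
      toℤ e f le = subst₂ _≤ℤ_ (⟦⟧ℤ-homo e) (⟦⟧ℤ-homo f) (+≤+ le)
      fromℤ : ∀ e f → ⟦ e ⟧ℤ ≤ℤ ⟦ f ⟧ℤ → ⟦ e ⟧ℕ ℕ.≤ ⟦ f ⟧ℕ
      fromℤ e f le with subst₂ _≤ℤ_ (sym (⟦⟧ℤ-homo e)) (sym (⟦⟧ℤ-homo f)) le
      ... | +≤+ le′ = le′
      κℤ : + κ ≡ + D * + M - + b
      κℤ = trans (solve 2 (λ k b → k := k :+ b :- b) refl (+ κ) (+ b))
                 (cong (_- + b) (trans (sym (⟦⟧ℤ-homo (‵ κ ⊞ ‵ b))) (trans (cong +_ κ+b≡DM) (⟦⟧ℤ-homo (‵ D ⊠ ‵ M)))))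
      hypℤ : NonNeg (⟦ fF ⟧ℤ - ⟦ eF ⟧ℤ)
      hypℤ = i≤j⇒0≤j-i (toℤ eF fF hyp)
      conclusionℤ = KeyInequality.polynomial-inequalityℤ (+ D) (+ M) (+ b) (+ N) (+ L) (+ N′) (+ L′)
        (nonNeg-ℕ D) (nonNeg-ℕ M) (nonNeg-ℕ b) (subst NonNeg κℤ (nonNeg-ℕ κ)) (+≤+ z≤n) (nonNeg-ℕ L) (nonNeg-ℕ N′) (nonNeg-ℕ L′)
        (subst (λ k → NonNeg (⟦ fF ⟧ℤ - (+ N * (+ M * (+ D + + b) + k) * (+ L + + L′) + + N))) κℤ hypℤ)
      goalℤ : ⟦ eG ⟧ℤ ≤ℤ ⟦ fG ⟧ℤ
      goalℤ = 0≤i-j⇒j≤i (subst (λ k → NonNeg (+ D * (+ M * (+ N + + N′) * k * + L + (+ L + + L′) * + b * (+ N + + N′))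
                                              - (+ D * (+ L + + L′) * + D * (+ M * + M) * + N + k * + N))) (sym κℤ) conclusionℤ)

open IntegerInequality using (polynomial-inequality)

open import Data.Nat hiding (_/_)
open import Data.Nat.Properties
open import Data.Nat.Solver using (module +-*-Solver)
open import Data.Nat.ListAction using (sum)
open import Data.Bool using (Bool; true; false; _∧_; _xor_; if_then_else_; not)
open import Data.Bool.Properties
  using (xor-assoc; xor-comm; xor-identityʳ; xor-same; ∧-distribˡ-xor; ∧-zeroʳ; ∧-comm; ∧-identityʳ; not-injective; xor-∧-commutativeRing; ∧-commutativeMonoid)
  renaming (_≟_ to _≟ᵇ_)
open import Data.Bool.Solver using (module xor-∧-Solver)
open import Algebra.Bundles using (CommutativeMonoid; CommutativeRing)
import Algebra.Properties.CommutativeSemigroup as CommutativeSemigroupProperties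
open CommutativeSemigroupProperties +-commutativeSemigroup using () renaming (interchange to +-interchange)
open CommutativeSemigroupProperties *-commutativeSemigroup using () renaming (x∙yz≈y∙xz to *-left-comm)
open CommutativeSemigroupProperties (CommutativeMonoid.commutativeSemigroup ∧-commutativeMonoid) using ()
  renaming (x∙yz≈y∙xz to ∧-left-comm)
open CommutativeSemigroupProperties (CommutativeRing.+-commutativeSemigroup xor-∧-commutativeRing) using ()
  renaming (interchange to xor-interchange)
open import Data.Bool.ListAction using (any)
open import Data.Fin using (zero; suc; punchIn; punchOut; inject₁; fromℕ) renaming (_≟_ to _≟ᶠ_)
open import Data.Fin.Properties using (any?; punchIn-punchOut; toℕ-injective; toℕ-inject₁; toℕ-inject≤; inject≤-refl)
open import Data.List using (List; []; _∷_; map; foldr; tabulate; _++_; concatMap)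
open import Data.List.Properties using (map-tabulate; foldr-map)
open import Data.List.Membership.Propositional using (_∈_)
open import Data.List.Membership.Propositional.Properties using (∈-map⁺; ∈-++⁺ˡ; ∈-++⁺ʳ)
open import Data.List.Relation.Unary.Any using (here; there)
open import Data.Vec.Functional using (insertAt)
open import Data.Vec.Functional.Properties using (insertAt-lookup; insertAt-punchIn)
open import Function using (_∘_; id)
open import Function.Definitions using (Congruent)
open import Relation.Nullary.Decidable using (_×-dec_)
open import Data.Integer as ℤ using (+≤+)
import Data.Integer.Properties as ℤP
open import Data.Integer.Solver renaming (module +-*-Solver to ℤ-Solver)
open import Data.Rational using (ℚ; 0ℚ; 1ℚ; ½; NonNegative; nonNegative; positive; toℚᵘ; _/_)
  renaming (_+_ to _+ℚ_; _*_ to _*ℚ_; _<_ to _<ℚ_)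
import Data.Rational.Properties as ℚP
open import Data.Rational.Unnormalised using (ℚᵘ; mkℚᵘ; *≡*; *≤*) renaming (_≃_ to _≃ᵘ_)
import Data.Rational.Unnormalised.Properties as ℚᵘP
open import Data.Rational.Solver renaming (module +-*-Solver to ℚ-Solver)

cong₃ : ∀ {A B C D : Set} (f : A → B → C → D) {a a′ b b′ c c′} → a ≡ a′ → b ≡ b′ → c ≡ c′ → f a b c ≡ f a′ b′ c′
cong₃ f refl refl refl = refl

sumFin-suc : ∀ m (f : Fin (suc m) → ℕ) → sumFin (suc m) f ≡ f zero + sumFin m (f ∘ suc)
sumFin-suc m f = trans (cong sum (map-tabulate id f)) (cong (f zero +_) (sym (cong sum (map-tabulate id (f ∘ suc)))))

xorSum-suc : ∀ m (f : Fin (suc m) → Bool) → xorSum (suc m) f ≡ f zero xor xorSum m (f ∘ suc)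
xorSum-suc m f = cong (f zero xor_) (trans (cong (foldr _ false) (sym (map-tabulate id sucᶠ))) (foldr-map _ sucᶠ false (tabulate id)))
  where sucᶠ : Fin m → Fin (suc m)
        sucᶠ = suc

sumFin-cong : ∀ m {f g : Fin m → ℕ} → f ≗ g → sumFin m f ≡ sumFin m g
sumFin-cong zero eq = refl
sumFin-cong (suc m) {f} {g} eq =
  trans (sumFin-suc m f) (trans (cong₂ _+_ (eq zero) (sumFin-cong m (eq ∘ suc))) (sym (sumFin-suc m g)))

sumFin-mono : ∀ m {f g : Fin m → ℕ} → (∀ i → f i ≤ g i) → sumFin m f ≤ sumFin m g
sumFin-mono zero le = ≤-refl
sumFin-mono (suc m) {f} {g} le rewrite sumFin-suc m f | sumFin-suc m g = +-mono-≤ (le zero) (sumFin-mono m (le ∘ suc))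

sumFin-zero : ∀ m → sumFin m (λ _ → 0) ≡ 0
sumFin-zero zero = refl
sumFin-zero (suc m) = trans (sumFin-suc m (λ _ → 0)) (sumFin-zero m)

sumFin-one : ∀ m → sumFin m (λ _ → 1) ≡ m
sumFin-one zero = refl
sumFin-one (suc m) = trans (sumFin-suc m (λ _ → 1)) (cong suc (sumFin-one m))

sumFin-+ : ∀ m (f g : Fin m → ℕ) → sumFin m (λ i → f i + g i) ≡ sumFin m f + sumFin m g
sumFin-+ zero f g = refl
sumFin-+ (suc m) f g rewrite sumFin-suc m (λ i → f i + g i) | sumFin-suc m f | sumFin-suc m g | sumFin-+ m (f ∘ suc) (g ∘ suc) =
  +-interchange (f zero) (g zero) (sumFin m (f ∘ suc)) (sumFin m (g ∘ suc))

sumFin-*ˡ : ∀ m c (f : Fin m → ℕ) → sumFin m (λ i → c * f i) ≡ c * sumFin m f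
sumFin-*ˡ zero c f = sym (*-zeroʳ c)
sumFin-*ˡ (suc m) c f rewrite sumFin-suc m (λ i → c * f i) | sumFin-suc m f | sumFin-*ˡ m c (f ∘ suc) =
  sym (*-distribˡ-+ c (f zero) _)

sumFin-swap : ∀ m p (f : Fin m → Fin p → ℕ) → sumFin m (λ i → sumFin p (f i)) ≡ sumFin p (λ j → sumFin m (λ i → f i j))
sumFin-swap zero p f = sym (sumFin-zero p)
sumFin-swap (suc m) p f rewrite sumFin-suc m (λ i → sumFin p (f i)) | sumFin-swap m p (f ∘ suc) =
  trans (sym (sumFin-+ p (f zero) (λ j → sumFin m (λ i → f (suc i) j)))) (sumFin-cong p (λ j → sym (sumFin-suc m (λ i → f i j))))

sumFin-last : ∀ m (g : Fin (suc m) → ℕ) → sumFin (suc m) g ≡ sumFin m (g ∘ inject₁) + g (fromℕ m)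
sumFin-last zero g = trans (sumFin-suc zero g) (+-comm (g zero) 0)
sumFin-last (suc m) g rewrite sumFin-suc (suc m) g | sumFin-last m (g ∘ suc) | sumFin-suc m (g ∘ inject₁) =
  sym (+-assoc (g zero) _ _)

sumFin≡0⇒≡0 : ∀ m (f : Fin m → ℕ) → sumFin m f ≡ 0 → ∀ j → f j ≡ 0
sumFin≡0⇒≡0 (suc m) f h zero = m+n≡0⇒m≡0 (f zero) (trans (sym (sumFin-suc m f)) h)
sumFin≡0⇒≡0 (suc m) f h (suc j) = sumFin≡0⇒≡0 m (f ∘ suc) (m+n≡0⇒n≡0 (f zero) (trans (sym (sumFin-suc m f)) h)) j

xorSum-cong : ∀ m {f g : Fin m → Bool} → f ≗ g → xorSum m f ≡ xorSum m g
xorSum-cong zero eq = refl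
xorSum-cong (suc m) {f} {g} eq rewrite xorSum-suc m f | xorSum-suc m g = cong₂ _xor_ (eq zero) (xorSum-cong m (eq ∘ suc))

xorSum-false : ∀ m → xorSum m (λ _ → false) ≡ false
xorSum-false zero = refl
xorSum-false (suc m) = trans (xorSum-suc m (λ _ → false)) (xorSum-false m)

xorSum-xor : ∀ m (f g : Fin m → Bool) → xorSum m (λ i → f i xor g i) ≡ xorSum m f xor xorSum m g
xorSum-xor zero f g = refl
xorSum-xor (suc m) f g rewrite xorSum-suc m (λ i → f i xor g i) | xorSum-suc m f | xorSum-suc m g | xorSum-xor m (f ∘ suc) (g ∘ suc) =
  xor-interchange (f zero) (g zero) _ _

xorSum-∧ : ∀ m a (f : Fin m → Bool) → xorSum m (λ i → a ∧ f i) ≡ a ∧ xorSum m f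
xorSum-∧ zero a f = sym (∧-zeroʳ a)
xorSum-∧ (suc m) a f rewrite xorSum-suc m (λ i → a ∧ f i) | xorSum-suc m f | xorSum-∧ m a (f ∘ suc) = sym (∧-distribˡ-xor a (f zero) _)

xorSum-swap : ∀ m p (f : Fin m → Fin p → Bool) → xorSum m (λ i → xorSum p (f i)) ≡ xorSum p (λ j → xorSum m (λ i → f i j))
xorSum-swap zero p f = sym (xorSum-false p)
xorSum-swap (suc m) p f rewrite xorSum-suc m (λ i → xorSum p (f i)) | xorSum-swap m p (f ∘ suc) =
  trans (sym (xorSum-xor p (f zero) (λ j → xorSum m (λ i → f (suc i) j)))) (xorSum-cong p (λ j → sym (xorSum-suc m (λ i → f i j))))

xorSum-last : ∀ m (g : Fin (suc m) → Bool) → xorSum (suc m) g ≡ xorSum m (g ∘ inject₁) xor g (fromℕ m)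
xorSum-last zero g = trans (xorSum-suc zero g) (xor-comm (g zero) false)
xorSum-last (suc m) g rewrite xorSum-suc (suc m) g | xorSum-last m (g ∘ suc) | xorSum-suc m (g ∘ inject₁) =
  sym (xor-assoc (g zero) _ _)

xorSum-punchIn : ∀ m (i : Fin (suc m)) (g : Fin (suc m) → Bool) → xorSum (suc m) g ≡ g i xor xorSum m (g ∘ punchIn i)
xorSum-punchIn m zero g = xorSum-suc m g
xorSum-punchIn (suc m) (suc i) g
  rewrite xorSum-suc (suc m) g | xorSum-punchIn m i (g ∘ suc) | xorSum-suc m (g ∘ punchIn (suc i)) =
  trans (sym (xor-assoc (g zero) (g (suc i)) rest)) (trans (cong (_xor rest) (xor-comm (g zero) (g (suc i)))) (xor-assoc (g (suc i)) (g zero) rest))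
  where rest = xorSum m (g ∘ suc ∘ punchIn i)

sumL-++ : ∀ {A : Set} (f : A → ℕ) xs ys → sumL f (xs ++ ys) ≡ sumL f xs + sumL f ys
sumL-++ f [] ys = refl
sumL-++ f (x ∷ xs) ys = trans (cong (f x +_) (sumL-++ f xs ys)) (sym (+-assoc (f x) _ _))

sumL-map : ∀ {A B : Set} (f : B → ℕ) (g : A → B) xs → sumL f (map g xs) ≡ sumL (f ∘ g) xs
sumL-map f g [] = refl
sumL-map f g (x ∷ xs) = cong (f (g x) +_) (sumL-map f g xs)

sumL-cong : ∀ {A : Set} {f g : A → ℕ} xs → f ≗ g → sumL f xs ≡ sumL g xs
sumL-cong [] eq = refl
sumL-cong (x ∷ xs) eq = cong₂ _+_ (eq x) (sumL-cong xs eq)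

sumL-mono : ∀ {A : Set} {f g : A → ℕ} xs → (∀ x → f x ≤ g x) → sumL f xs ≤ sumL g xs
sumL-mono [] le = ≤-refl
sumL-mono (x ∷ xs) le = +-mono-≤ (le x) (sumL-mono xs le)

sumL-zero : ∀ {A : Set} (xs : List A) → sumL (λ _ → 0) xs ≡ 0
sumL-zero [] = refl
sumL-zero (x ∷ xs) = sumL-zero xs

sumL-+ : ∀ {A : Set} (f g : A → ℕ) xs → sumL (λ x → f x + g x) xs ≡ sumL f xs + sumL g xs
sumL-+ f g [] = refl
sumL-+ f g (x ∷ xs) rewrite sumL-+ f g xs = +-interchange (f x) (g x) (sumL f xs) (sumL g xs)

sumL-*ˡ : ∀ {A : Set} (c : ℕ) (f : A → ℕ) xs → sumL (λ x → c * f x) xs ≡ c * sumL f xs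
sumL-*ˡ c f [] = sym (*-zeroʳ c)
sumL-*ˡ c f (x ∷ xs) rewrite sumL-*ˡ c f xs = sym (*-distribˡ-+ c (f x) _)

sumL-sumFin : ∀ {A : Set} m (f : A → Fin m → ℕ) xs → sumL (λ x → sumFin m (f x)) xs ≡ sumFin m (λ j → sumL (λ x → f x j) xs)
sumL-sumFin m f [] = sym (sumFin-zero m)
sumL-sumFin m f (x ∷ xs) rewrite sumL-sumFin m f xs = sym (sumFin-+ m (f x) _)

snoc-inject₁ : ∀ {A : Set} {m} (f : Fin m → A) (x : A) (i : Fin m) → snoc f x (inject₁ i) ≡ f i
snoc-inject₁ {m = suc m} f x zero = refl
snoc-inject₁ {m = suc m} f x (suc i) = snoc-inject₁ (f ∘ suc) x i

snoc-last : ∀ {A : Set} {m} (f : Fin m → A) (x : A) → snoc f x (fromℕ m) ≡ x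
snoc-last {m = zero} f x = refl
snoc-last {m = suc m} f x = snoc-last (f ∘ suc) x

snoc-cong : ∀ {A : Set} {m} {f g : Fin m → A} {x y : A} → f ≗ g → x ≡ y → snoc f x ≗ snoc g y
snoc-cong {m = zero} ef refl zero = refl
snoc-cong {m = suc m} ef ex zero = ef zero
snoc-cong {m = suc m} ef ex (suc l) = snoc-cong (ef ∘ suc) ex l

snoc-zipWith : ∀ {A B C : Set} {m} (h : A → B → C) (f : Fin m → A) (g : Fin m → B) x y →
  snoc (λ i → h (f i) (g i)) (h x y) ≗ (λ l → h (snoc f x l) (snoc g y l))
snoc-zipWith {m = zero} h f g x y zero = refl
snoc-zipWith {m = suc m} h f g x y zero = refl
snoc-zipWith {m = suc m} h f g x y (suc l) = snoc-zipWith h (f ∘ suc) (g ∘ suc) x y l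

snoc-η : ∀ {A : Set} {s} (G : Fin (suc s) → A) → G ≗ snoc (G ∘ inject₁) (G (fromℕ s))
snoc-η {s = zero} G zero = refl
snoc-η {s = suc s} G zero = refl
snoc-η {s = suc s} G (suc l) = snoc-η (G ∘ suc) l

snoc-view : ∀ {m} (l : Fin (suc m)) → (∃ λ i → l ≡ inject₁ i) ⊎ l ≡ fromℕ m
snoc-view {zero} zero = inj₂ refl
snoc-view {suc m} zero = inj₁ (zero , refl)
snoc-view {suc m} (suc l) with snoc-view {m} l
... | inj₁ (i , eq) = inj₁ (suc i , cong suc eq)
... | inj₂ eq = inj₂ (cong suc eq)

b2n≤1 : ∀ a → b2n a ≤ 1
b2n≤1 true = ≤-refl
b2n≤1 false = z≤n

b2n-∧ : ∀ a b → b2n (a ∧ b) ≡ b2n a * b2n b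
b2n-∧ true b = sym (+-identityʳ (b2n b))
b2n-∧ false b = refl

b2n-* : ∀ c x → b2n c * x ≡ (if c then x else 0)
b2n-* true x = +-identityʳ x
b2n-* false x = refl

b2n-xor : ∀ a b → b2n (a xor b) ≤ b2n a + b2n b
b2n-xor true true = z≤n
b2n-xor true false = s≤s z≤n
b2n-xor false b = ≤-refl

b2n-xorSum : ∀ m (h : Fin m → Bool) → b2n (xorSum m h) ≤ sumFin m (b2n ∘ h)
b2n-xorSum zero h = z≤n
b2n-xorSum (suc m) h rewrite xorSum-suc m h | sumFin-suc m (b2n ∘ h) =
  ≤-trans (b2n-xor (h zero) _) (+-monoʳ-≤ (b2n (h zero)) (b2n-xorSum m (h ∘ suc)))

b2n-triangle : ∀ a b c → b2n (a xor c) ≤ b2n (a xor b) + b2n (b xor c)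
b2n-triangle a b c = subst (λ x → b2n x ≤ b2n (a xor b) + b2n (b xor c)) (xor-cancel a b c) (b2n-xor (a xor b) (b xor c))
  where
    xor-cancel : ∀ a b c → (a xor b) xor (b xor c) ≡ a xor c
    xor-cancel = solve 3 (λ a b c → (a :+ b) :+ (b :+ c) := a :+ c) refl
      where open xor-∧-Solver

wt-cong : ∀ {m} {u v : Bits m} → u ≗ v → wt u ≡ wt v
wt-cong {m} eq = sumFin-cong m (cong b2n ∘ eq)

wt≤length : ∀ {m} (u : Bits m) → wt u ≤ m
wt≤length {m} u = subst (wt u ≤_) (sumFin-one m) (sumFin-mono m (b2n≤1 ∘ u))

wt-triangle : ∀ {m} (u v w : Bits m) → wt (u ⊕ w) ≤ wt (u ⊕ v) + wt (v ⊕ w)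
wt-triangle {m} u v w = subst (wt (u ⊕ w) ≤_) (sumFin-+ m _ _) (sumFin-mono m (λ i → b2n-triangle (u i) (v i) (w i)))

wt-comm : ∀ {m} (u v : Bits m) → wt (u ⊕ v) ≡ wt (v ⊕ u)
wt-comm {m} u v = sumFin-cong m (λ i → cong b2n (xor-comm (u i) (v i)))

eqBits-suc : ∀ {m} (u v : Bits (suc m)) → eqBits u v ≡ not (u zero xor v zero) ∧ eqBits (u ∘ suc) (v ∘ suc)
eqBits-suc {m} u v = cong (foldr _∧_ true) (trans (map-tabulate id (λ i → not (u i xor v i)))
  (cong (not (u zero xor v zero) ∷_) (sym (map-tabulate id (λ i → not (u (suc i) xor v (suc i)))))))

∧≡true⇒ : ∀ {a b} → a ∧ b ≡ true → a ≡ true × b ≡ true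
∧≡true⇒ {true} {true} _ = refl , refl

not-xor≡true⇒≡ : ∀ {a b} → not (a xor b) ≡ true → a ≡ b
not-xor≡true⇒≡ {true} {true} _ = refl
not-xor≡true⇒≡ {false} {false} _ = refl

≡⇒not-xor≡true : ∀ {a b} → a ≡ b → not (a xor b) ≡ true
≡⇒not-xor≡true {true} refl = refl
≡⇒not-xor≡true {false} refl = refl

eqBits⇒≗ : ∀ {m} (u v : Bits m) → eqBits u v ≡ true → u ≗ v
eqBits⇒≗ {suc m} u v eq zero = not-xor≡true⇒≡ (proj₁ (∧≡true⇒ (trans (sym (eqBits-suc u v)) eq)))
eqBits⇒≗ {suc m} u v eq (suc i) = eqBits⇒≗ (u ∘ suc) (v ∘ suc) (proj₂ (∧≡true⇒ (trans (sym (eqBits-suc u v)) eq))) i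

≗⇒eqBits : ∀ {m} (u v : Bits m) → u ≗ v → eqBits u v ≡ true
≗⇒eqBits {zero} u v eq = refl
≗⇒eqBits {suc m} u v eq = trans (eqBits-suc u v) (cong₂ _∧_ (≡⇒not-xor≡true (eq zero)) (≗⇒eqBits (u ∘ suc) (v ∘ suc) (eq ∘ suc)))

≡true-ext : ∀ {a b : Bool} → (a ≡ true → b ≡ true) → (b ≡ true → a ≡ true) → a ≡ b
≡true-ext {true} f g = sym (f refl)
≡true-ext {false} {true} f g = g refl
≡true-ext {false} {false} f g = refl

eqBits-cong : ∀ {m} {u u′ v v′ : Bits m} → u ≗ u′ → v ≗ v′ → eqBits u v ≡ eqBits u′ v′
eqBits-cong {u = u} {u′} {v} {v′} eu ev = ≡true-ext
  (λ e → ≗⇒eqBits u′ v′ (λ i → trans (sym (eu i)) (trans (eqBits⇒≗ u v e i) (ev i))))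
  (λ e → ≗⇒eqBits u v (λ i → trans (eu i) (trans (eqBits⇒≗ u′ v′ e i) (sym (ev i)))))

∈-concatMap : ∀ {A B : Set} (f : A → List B) {x : A} {y : B} xs → x ∈ xs → y ∈ f x → y ∈ concatMap f xs
∈-concatMap f (x ∷ xs) (here refl) y∈ = ∈-++⁺ˡ y∈
∈-concatMap f (x ∷ xs) (there x∈) y∈ = ∈-++⁺ʳ (f x) (∈-concatMap f xs x∈ y∈)

allFuns-complete : ∀ {A B : Set} (R : A → B → Set) (xs : List A) → (∀ b → ∃ λ a → a ∈ xs × R a b)
  → ∀ m (g : Fin m → B) → ∃ λ f → f ∈ allFuns xs m × (∀ i → R (f i) (g i))
allFuns-complete R xs cover zero g = (λ ()) , here refl , (λ ())
allFuns-complete R xs cover (suc m) g with cover (g zero) | allFuns-complete R xs cover m (g ∘ suc)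
... | a , a∈ , ra | f , f∈ , rf =
  (a ∷ᶠ f) , ∈-concatMap (λ x → map (x ∷ᶠ_) (allFuns xs m)) xs a∈ (∈-map⁺ (a ∷ᶠ_) f∈) , λ { zero → ra ; (suc i) → rf i }

allBits-complete : ∀ m (v : Bits m) → ∃ λ w → w ∈ allBits m × w ≗ v
allBits-complete m v = allFuns-complete _≡_ (true ∷ false ∷ []) cover m v
  where cover : ∀ b → ∃ λ a → a ∈ (true ∷ false ∷ []) × a ≡ b
        cover true = true , here refl , refl
        cover false = false , there (here refl) , refl

allMats-complete : ∀ p q (M : Mat p q) → ∃ λ M′ → M′ ∈ allMats p q × (∀ i → M′ i ≗ M i)
allMats-complete p q M = allFuns-complete _≗_ (allBits q) (allBits-complete q) p M

minL-≤ : ∀ {A : Set} (f : A → ℕ) x₀ {xs y} → y ∈ xs → minL f x₀ xs ≤ f y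
minL-≤ f x₀ {x ∷ xs} (here refl) = m⊓n≤m (f x) _
minL-≤ f x₀ {x ∷ xs} (there y∈) = ≤-trans (m⊓n≤n (f x) _) (minL-≤ f x₀ y∈)

sumL-allBits-suc : ∀ m (g : Bits (suc m) → ℕ) →
  sumL g (allBits (suc m)) ≡ sumL (g ∘ (true ∷ᶠ_)) (allBits m) + sumL (g ∘ (false ∷ᶠ_)) (allBits m)
sumL-allBits-suc m g = trans (sumL-++ g (map (true ∷ᶠ_) (allBits m)) _)
  (cong₂ _+_ (sumL-map g (true ∷ᶠ_) (allBits m))
    (trans (sumL-++ g (map (false ∷ᶠ_) (allBits m)) []) (trans (+-identityʳ _) (sumL-map g (false ∷ᶠ_) (allBits m)))))

sumL-allBits-1 : ∀ m → sumL (λ _ → 1) (allBits m) ≡ 2 ^ m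
sumL-allBits-1 zero = refl
sumL-allBits-1 (suc m) =
  trans (sumL-allBits-suc m (λ _ → 1)) (trans (cong₂ _+_ (sumL-allBits-1 m) (sumL-allBits-1 m)) (cong (2 ^ m +_) (sym (+-identityʳ (2 ^ m)))))

sumL-allBits-point : ∀ m (v : Bits m) (h : Bits m → ℕ) → (∀ {y y′} → y ≗ y′ → h y ≡ h y′) →
  sumL (λ y → if eqBits v y then h y else 0) (allBits m) ≡ h v
sumL-allBits-point zero v h h-cong = trans (+-identityʳ _) (h-cong (λ ()))
sumL-allBits-point (suc m) v h h-cong =
  begin
    sumL g (allBits (suc m))
  ≡⟨ sumL-allBits-suc m g ⟩
    sumL (g ∘ (true ∷ᶠ_)) (allBits m) + sumL (g ∘ (false ∷ᶠ_)) (allBits m)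
  ≡⟨ split (v zero) refl ⟩
    h v
  ∎
  where
    open ≡-Reasoning
    g : Bits (suc m) → ℕ
    g y = if eqBits v y then h y else 0
    head-test : ∀ x w → g (x ∷ᶠ w) ≡ (if not (v zero xor x) ∧ eqBits (v ∘ suc) w then h (x ∷ᶠ w) else 0)
    head-test x w = cong (λ b → if b then h (x ∷ᶠ w) else 0) (eqBits-suc v (x ∷ᶠ w))
    slice-hit : ∀ x → v zero ≡ x → sumL (g ∘ (x ∷ᶠ_)) (allBits m) ≡ h v
    slice-hit x e = trans (sumL-cong (allBits m) (λ w → trans (head-test x w)
                      (cong (λ b → if b ∧ eqBits (v ∘ suc) w then h (x ∷ᶠ w) else 0) (≡⇒not-xor≡true e))))
                    (trans (sumL-allBits-point m (v ∘ suc) (h ∘ (x ∷ᶠ_)) (λ eq → h-cong (λ { zero → refl ; (suc i) → eq i })))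
                           (h-cong (λ { zero → sym e ; (suc i) → refl })))
    slice-miss : ∀ x → not (v zero xor x) ≡ false → sumL (g ∘ (x ∷ᶠ_)) (allBits m) ≡ 0
    slice-miss x e = trans (sumL-cong (allBits m) (λ w → trans (head-test x w)
                       (cong (λ b → if b ∧ eqBits (v ∘ suc) w then h (x ∷ᶠ w) else 0) e))) (sumL-zero (allBits m))
    split : ∀ a → v zero ≡ a → sumL (g ∘ (true ∷ᶠ_)) (allBits m) + sumL (g ∘ (false ∷ᶠ_)) (allBits m) ≡ h v
    split true e = trans (cong₂ _+_ (slice-hit true e) (slice-miss false (cong (λ a → not (a xor false)) e))) (+-identityʳ _)
    split false e = cong₂ _+_ (slice-miss true (cong (λ a → not (a xor true)) e)) (slice-hit false e)

any-complete : ∀ {A : Set} (p : A → Bool) {x} xs → x ∈ xs → p x ≡ true → any p xs ≡ true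
any-complete p (x ∷ xs) (here refl) px rewrite px = refl
any-complete p (y ∷ xs) (there x∈) px with p y
... | true = refl
... | false = any-complete p xs x∈ px

any-sound : ∀ {A : Set} (p : A → Bool) xs → any p xs ≡ true → ∃ λ x → p x ≡ true
any-sound p (x ∷ xs) h with p x in e
... | true = x , e
... | false = any-sound p xs h

isZero : ∀ {q} → Bits q → Bool
isZero y = eqBits zeroBits y

isZero≡false⇒∃true : ∀ {q} (y : Bits q) → isZero y ≡ false → ∃ λ p → y p ≡ true
isZero≡false⇒∃true {suc q} y h = split (y zero) refl (trans (sym (eqBits-suc zeroBits y)) h)
  where
    split : ∀ x → y zero ≡ x → not (y zero) ∧ isZero (y ∘ suc) ≡ false → ∃ λ p → y p ≡ true
    split true e _ = zero , e
    split false e h′ with isZero≡false⇒∃true (y ∘ suc) (trans (cong (λ a → not a ∧ isZero (y ∘ suc)) (sym e)) h′)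
    ... | p , yp = suc p , yp

lincomb-cong : ∀ {s k} {F G : Fin s → Bits k} {x y : Bits s} → (∀ l → F l ≗ G l) → x ≗ y → lincomb F x ≗ lincomb G y
lincomb-cong {s} eF ex t = xorSum-cong s (λ l → cong₂ _∧_ (ex l) (eF l t))

·v-cong : ∀ {p m} (U : Mat p m) {u v : Bits m} → u ≗ v → (U ·v u) ≗ (U ·v v)
·v-cong {m = m} U eq i = xorSum-cong m (λ l → cong (U i l ∧_) (eq l))

·v-lincomb : ∀ {p k s} (U : Mat p k) (F : Fin s → Bits k) (x : Bits s) → (U ·v lincomb F x) ≗ lincomb (λ l → U ·v F l) x
·v-lincomb {p} {k} {s} U F x i =
  trans (xorSum-cong k (λ t → sym (xorSum-∧ s (U i t) (λ l → x l ∧ F l t))))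
  (trans (xorSum-swap k s (λ t l → U i t ∧ (x l ∧ F l t)))
  (xorSum-cong s (λ l → trans (xorSum-cong k (λ t → ∧-left-comm (U i t) (x l) (F l t))) (xorSum-∧ k (x l) (λ t → U i t ∧ F l t)))))

lincomb-snoc : ∀ {m k} (bs : Fin m → Bits k) (b : Bits k) (x : Bits m) (β : Bool) →
  lincomb (snoc bs b) (snoc x β) ≗ (λ t → lincomb bs x t xor (β ∧ b t))
lincomb-snoc {m} bs b x β t = trans (xorSum-last m (λ l → snoc x β l ∧ snoc bs b l t))
  (cong₂ _xor_ (xorSum-cong m (λ i → cong₂ _∧_ (snoc-inject₁ x β i) (cong-app (snoc-inject₁ bs b i) t)))
               (cong₂ _∧_ (snoc-last x β) (cong-app (snoc-last bs b) t)))

wt-lincomb : ∀ {s k} (F G : Fin s → Bits k) (x : Bits s) →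
  wt (lincomb F x ⊕ lincomb G x) ≤ sumFin s (λ l → b2n (x l) * wt (F l ⊕ G l))
wt-lincomb {s} {k} F G x =
  begin
    wt (lincomb F x ⊕ lincomb G x)
  ≡⟨ wt-cong (λ t → trans (sym (xorSum-xor s (λ l → x l ∧ F l t) (λ l → x l ∧ G l t))) (xorSum-cong s (λ l → sym (∧-distribˡ-xor (x l) (F l t) (G l t))))) ⟩
    sumFin k (λ t → b2n (xorSum s (λ l → x l ∧ (F l t xor G l t))))
  ≤⟨ sumFin-mono k (λ t → b2n-xorSum s _) ⟩
    sumFin k (λ t → sumFin s (λ l → b2n (x l ∧ (F l t xor G l t))))
  ≡⟨ sumFin-swap k s _ ⟩
    sumFin s (λ l → sumFin k (λ t → b2n (x l ∧ (F l t xor G l t))))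
  ≡⟨ sumFin-cong s (λ l → trans (sumFin-cong k (λ t → b2n-∧ (x l) _)) (sumFin-*ˡ k (b2n (x l)) _)) ⟩
    sumFin s (λ l → b2n (x l) * wt (F l ⊕ G l))
  ∎
  where open ≤-Reasoning

inSpan-sound : ∀ {s k} (F : Fin s → Bits k) {c} → inSpan F c ≡ true → ∃ λ x → lincomb F x ≗ c
inSpan-sound F {c} h with any-sound _ (allBits _) h
... | x , hx = x , eqBits⇒≗ _ c hx

inSpan-complete : ∀ {s k} (F : Fin s → Bits k) {c} x → lincomb F x ≗ c → inSpan F c ≡ true
inSpan-complete {s} F {c} x h with allBits-complete s x
... | x′ , x′∈ , x′≗x = any-complete (λ y → eqBits (lincomb F y) c) (allBits s) x′∈
       (≗⇒eqBits _ c (λ t → trans (lincomb-cong {F = F} (λ _ _ → refl) x′≗x t) (h t)))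

inSpan-cong : ∀ {s k} (F : Fin s → Bits k) {c c′} → c ≗ c′ → inSpan F c ≡ inSpan F c′
inSpan-cong F eq = ≡true-ext
  (λ h → inSpan-complete F (proj₁ (inSpan-sound F h)) (λ t → trans (proj₂ (inSpan-sound F h) t) (eq t)))
  (λ h → inSpan-complete F (proj₁ (inSpan-sound F h)) (λ t → trans (proj₂ (inSpan-sound F h) t) (sym (eq t))))

lincomb-snocˡ : ∀ {s k} (F : Fin (suc s) → Bits k) (x : Bits s) (β : Bool) →
  lincomb F (snoc x β) ≗ (λ t → lincomb (F ∘ inject₁) x t xor (β ∧ F (fromℕ s) t))
lincomb-snocˡ {s} F x β t = trans (xorSum-last s (λ l → snoc x β l ∧ F l t))
  (cong₂ _xor_ (xorSum-cong s (λ l → cong (_∧ F (inject₁ l) t) (snoc-inject₁ x β l))) (cong (_∧ F (fromℕ s) t) (snoc-last x β)))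

LinIndep-init : ∀ {s k} (F : Fin (suc s) → Bits k) → LinIndep F → LinIndep (F ∘ inject₁)
LinIndep-init {s} F li x h i = trans (sym (snoc-inject₁ x false i)) (li (snoc x false) vanishes (inject₁ i))
  where vanishes : ∀ t → lincomb F (snoc x false) t ≡ false
        vanishes t = trans (lincomb-snocˡ F x false t) (trans (xor-identityʳ _) (h t))

LinIndep-last∉span : ∀ {s k} (F : Fin (suc s) → Bits k) → LinIndep F → ∀ x → ¬ (lincomb (F ∘ inject₁) x ≗ F (fromℕ s))
LinIndep-last∉span {s} F li x h = true≢false (trans (sym (snoc-last x true)) (li (snoc x true) vanishes (fromℕ s)))
  where
    true≢false : true ≢ false
    true≢false ()
    vanishes : ∀ t → lincomb F (snoc x true) t ≡ false
    vanishes t = trans (lincomb-snocˡ F x true t) (trans (cong (_xor F (fromℕ s) t) (h t)) (xor-same (F (fromℕ s) t)))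

Linear : ∀ {k q} → (Bits k → Bits q) → Set
Linear {k} π = ∀ (u v : Bits k) → π (u ⊕ v) ≗ (π u ⊕ π v)

scale : ∀ {k} → Bool → Bits k → Bits k
scale β b t = β ∧ b t

module _ {k q} {π : Bits k → Bits q} (π-linear : Linear π) (π-cong : Congruent _≗_ _≗_ π) where

  linear-zero : π zeroBits ≗ zeroBits
  linear-zero i = x≡x⊕x⇒x≡false (trans (sym (π-cong (λ _ → refl) i)) (π-linear zeroBits zeroBits i))
    where x≡x⊕x⇒x≡false : ∀ {a} → a ≡ a xor a → a ≡ false
          x≡x⊕x⇒x≡false {false} _ = refl

  linear-scale : ∀ β b → π (scale β b) ≗ scale β (π b)
  linear-scale true b = π-cong (λ _ → refl)
  linear-scale false b i = trans (π-cong (λ _ → refl) i) (linear-zero i)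

  linear-kills-span : ∀ {s} (F : Fin s → Bits k) → (∀ l → π (F l) ≗ zeroBits) → ∀ x → π (lincomb F x) ≗ zeroBits
  linear-kills-span {zero} F kills x t = trans (π-cong (λ _ → refl) t) (linear-zero t)
  linear-kills-span {suc s} F kills x t =
    trans (π-cong (λ t′ → xorSum-suc s (λ l → x l ∧ F l t′)) t)
      (trans (π-linear (scale (x zero) (F zero)) (lincomb (F ∘ suc) (x ∘ suc)) t)
        (trans (cong₂ _xor_ (trans (linear-scale (x zero) (F zero) t) (cong (x zero ∧_) (kills zero t)))
                            (linear-kills-span (F ∘ suc) (kills ∘ suc) (x ∘ suc) t))
               (cong (_xor false) (∧-zeroʳ (x zero)))))

-- π is the quotient map of Bits k onto Bits k / span bs ≅ Bits r, and φ reads off the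
-- coordinates (with respect to bs) of the vectors in its kernel.
record Quotient {m k} (bs : Fin m → Bits k) (r : ℕ) : Set where
  field
    π : Bits k → Bits r
    φ : Bits k → Bits m
    π-linear : Linear π
    π-cong : Congruent _≗_ _≗_ π
    π-surjective : ∀ y → ∃ λ c → π c ≗ y
    φ-linear : Linear φ
    φ-cong : Congruent _≗_ _≗_ φ
    φ-coordinates : ∀ c → π c ≗ zeroBits → lincomb bs (φ c) ≗ c
    π-kills : ∀ i → π (bs i) ≗ zeroBits

Quotient-cong : ∀ {s k r} {F G : Fin s → Bits k} → (∀ i → F i ≗ G i) → Quotient F r → Quotient G r
Quotient-cong eq q = record
  { π = π ; φ = φ ; π-linear = π-linear ; π-cong = π-cong ; π-surjective = π-surjective ; φ-linear = φ-linear ; φ-cong = φ-cong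
  ; φ-coordinates = λ c h t → trans (sym (lincomb-cong {x = φ c} eq (λ _ → refl) t)) (φ-coordinates c h t)
  ; π-kills = λ i t → trans (sym (π-cong (eq i) t)) (π-kills i t) }
  where open Quotient q

identityQuotient : ∀ {k} → Quotient {zero} {k} (λ ()) k
identityQuotient = record
  { π = id ; φ = λ _ () ; π-linear = λ u v i → refl ; π-cong = id ; π-surjective = λ y → y , (λ _ → refl)
  ; φ-linear = λ u v () ; φ-cong = λ _ () ; φ-coordinates = λ c h t → sym (h t) ; π-kills = λ () }

≡⊎punchIn : ∀ {r} (p t : Fin (suc r)) → t ≡ p ⊎ ∃ λ i → punchIn p i ≡ t
≡⊎punchIn p t with p ≟ᶠ t
... | yes eq = inj₁ (sym eq)
... | no ne = inj₂ (punchOut ne , punchIn-punchOut ne)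

-- Adjoining b to bs: coordinate p of the quotient, on which π b is nonzero, is eliminated.
module Extension {m k r} {bs : Fin m → Bits k} (q : Quotient bs (suc r))
                 (b : Bits k) (p : Fin (suc r)) (πb-p : Quotient.π q b p ≡ true) where

  open Quotient q

  w : Bits (suc r)
  w = π b

  β : Bits k → Bool
  β c = π c p

  ρ : Bits (suc r) → Bits r
  ρ y i = y (punchIn p i) xor (y p ∧ w (punchIn p i))

  π′ : Bits k → Bits r
  π′ = ρ ∘ π

  reduce : Bits k → Bits k
  reduce c = c ⊕ scale (β c) b

  φ′ : Bits k → Bits (suc m)
  φ′ c = snoc (φ (reduce c)) (β c)

  bs′ : Fin (suc m) → Bits k
  bs′ = snoc bs b

  private
    xor-∧-distribʳ : ∀ a a′ c c′ v → (a xor a′) xor ((c xor c′) ∧ v) ≡ (a xor (c ∧ v)) xor (a′ xor (c′ ∧ v))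
    xor-∧-distribʳ = solve 5 (λ a a′ c c′ v → (a :+ a′) :+ ((c :+ c′) :* v) := (a :+ (c :* v)) :+ (a′ :+ (c′ :* v))) refl
      where open xor-∧-Solver

  π′-linear : Linear π′
  π′-linear u v i = trans (cong₂ (λ s t → s xor (t ∧ w (punchIn p i))) (π-linear u v (punchIn p i)) (π-linear u v p))
                          (xor-∧-distribʳ (π u (punchIn p i)) (π v (punchIn p i)) (π u p) (π v p) (w (punchIn p i)))

  π′-cong : Congruent _≗_ _≗_ π′
  π′-cong eq i = cong₂ (λ s t → s xor (t ∧ w (punchIn p i))) (π-cong eq (punchIn p i)) (π-cong eq p)

  π-reduce : ∀ c t → π (reduce c) t ≡ π c t xor (β c ∧ w t)
  π-reduce c t = trans (π-linear c (scale (β c) b) t) (cong (π c t xor_) (linear-scale π-linear π-cong (β c) b t))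

  π′≗0⇒π-reduce≗0 : ∀ c → π′ c ≗ zeroBits → π (reduce c) ≗ zeroBits
  π′≗0⇒π-reduce≗0 c h t with ≡⊎punchIn p t
  ... | inj₁ refl = trans (π-reduce c p) (trans (cong (λ z → π c p xor (π c p ∧ z)) πb-p) (x⊕x∧true (π c p)))
    where x⊕x∧true : ∀ x → x xor (x ∧ true) ≡ false
          x⊕x∧true true = refl
          x⊕x∧true false = refl
  ... | inj₂ (i , refl) = trans (π-reduce c (punchIn p i)) (h i)

  π≗0⇒π′≗0 : ∀ c → π c ≗ zeroBits → π′ c ≗ zeroBits
  π≗0⇒π′≗0 c h i rewrite h (punchIn p i) | h p = refl

  π′b≗0 : π′ b ≗ zeroBits
  π′b≗0 i rewrite πb-p = xor-same (w (punchIn p i))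

  β-linear : ∀ u v → β (u ⊕ v) ≡ β u xor β v
  β-linear u v = π-linear u v p

  reduce-linear : Linear reduce
  reduce-linear u v t = trans (cong (λ z → (u t xor v t) xor (z ∧ b t)) (β-linear u v)) (xor-∧-distribʳ (u t) (v t) (β u) (β v) (b t))

  reduce-cong : Congruent _≗_ _≗_ reduce
  reduce-cong eq t = cong₂ (λ s z → s xor (z ∧ b t)) (eq t) (π-cong eq p)

  φ′-linear : Linear φ′
  φ′-linear u v l = trans (snoc-cong (λ i → trans (φ-cong (reduce-linear u v) i) (φ-linear (reduce u) (reduce v) i)) (β-linear u v) l)
                          (snoc-zipWith _xor_ (φ (reduce u)) (φ (reduce v)) (β u) (β v) l)

  φ′-cong : Congruent _≗_ _≗_ φ′
  φ′-cong eq = snoc-cong (φ-cong (reduce-cong eq)) (π-cong eq p)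

  φ′-coordinates : ∀ c → π′ c ≗ zeroBits → lincomb bs′ (φ′ c) ≗ c
  φ′-coordinates c h t = trans (lincomb-snoc bs b (φ (reduce c)) (β c) t)
    (trans (cong (_xor (β c ∧ b t)) (φ-coordinates (reduce c) (π′≗0⇒π-reduce≗0 c h) t)) (xor-cancelʳ (c t) (β c ∧ b t)))
    where xor-cancelʳ : ∀ a c → (a xor c) xor c ≡ a
          xor-cancelʳ a c = trans (xor-assoc a c c) (trans (cong (a xor_) (xor-same c)) (xor-identityʳ a))

  π′-surjective : ∀ y → ∃ λ c → π′ c ≗ y
  π′-surjective y with π-surjective (insertAt y p false)
  ... | c , πc≗ = c , λ i → trans (cong₂ (λ s z → s xor (z ∧ w (punchIn p i))) (πc≗ (punchIn p i)) (πc≗ p))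
                            (trans (cong₂ (λ s z → s xor (z ∧ w (punchIn p i))) (insertAt-punchIn y p false i) (insertAt-lookup y p false))
                                   (xor-identityʳ (y i)))

  π′-kills : ∀ l → π′ (bs′ l) ≗ zeroBits
  π′-kills l with snoc-view l
  ... | inj₁ (i , refl) = λ t → trans (π′-cong (cong-app (snoc-inject₁ bs b i)) t) (π≗0⇒π′≗0 (bs i) (π-kills i) t)
  ... | inj₂ refl = λ t → trans (π′-cong (cong-app (snoc-last bs b)) t) (π′b≗0 t)

  extension : Quotient bs′ r
  extension = record
    { π = π′ ; φ = φ′ ; π-linear = π′-linear ; π-cong = π′-cong ; π-surjective = π′-surjective
    ; φ-linear = φ′-linear ; φ-cong = φ′-cong ; φ-coordinates = φ′-coordinates ; π-kills = π′-kills }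

  -- π′ c vanishes exactly when π c is 0 or π b, and β c tells which.
  π≗0-case : ∀ c → isZero (π c) ≡ true → eqBits (π c) w ≡ false × isZero (π′ c) ≡ true × β c ≡ false
  π≗0-case c h = πc≢w , ≗⇒eqBits zeroBits (π′ c) (λ i → sym (π≗0⇒π′≗0 c (λ t → sym (0≗πc t)) i)) , sym (0≗πc p)
    where
      0≗πc : zeroBits ≗ π c
      0≗πc = eqBits⇒≗ zeroBits (π c) h
      πc≢w : eqBits (π c) w ≡ false
      πc≢w with eqBits (π c) w in e
      ... | false = refl
      ... | true with trans (0≗πc p) (trans (eqBits⇒≗ (π c) w e p) πb-p)
      ...   | ()

  π≗w-case : ∀ c → eqBits (π c) w ≡ true → isZero (π c) ≡ false × isZero (π′ c) ≡ true × β c ≡ true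
  π≗w-case c h = πc≢0 , ≗⇒eqBits zeroBits (π′ c) (λ i → sym (trans (π′-cong′ i) (π′b≗0 i))) , trans (πc≗w p) πb-p
    where
      πc≗w : π c ≗ w
      πc≗w = eqBits⇒≗ (π c) w h
      π′-cong′ : π′ c ≗ π′ b
      π′-cong′ i = cong₂ (λ s z → s xor (z ∧ w (punchIn p i))) (πc≗w (punchIn p i)) (πc≗w p)
      πc≢0 : isZero (π c) ≡ false
      πc≢0 with isZero (π c) in e
      ... | false = refl
      ... | true with trans (eqBits⇒≗ zeroBits (π c) e p) (trans (πc≗w p) πb-p)
      ...   | ()

  π≢0,w-case : ∀ c → isZero (π c) ≡ false → eqBits (π c) w ≡ false → isZero (π′ c) ≡ false
  π≢0,w-case c πc≢0 πc≢w with isZero (π′ c) in e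
  ... | false = refl
  ... | true = ⊥-elim (contradiction-on (β c) refl)
    where
      πc≗βw : ∀ t → π c t xor (β c ∧ w t) ≡ false
      πc≗βw t = trans (sym (π-reduce c t)) (π′≗0⇒π-reduce≗0 c (λ i → sym (eqBits⇒≗ zeroBits (π′ c) e i)) t)
      x⊕y≡false⇒x≡y : ∀ {x y} → x xor y ≡ false → x ≡ y
      x⊕y≡false⇒x≡y {true} {true} _ = refl
      x⊕y≡false⇒x≡y {false} {false} _ = refl
      contradiction-on : ∀ x → β c ≡ x → ⊥
      contradiction-on false e′ with trans (sym (≗⇒eqBits zeroBits (π c) λ t →
                                    sym (x⊕y≡false⇒x≡y (trans (cong (λ z → π c t xor (z ∧ w t)) (sym e′)) (πc≗βw t))))) πc≢0
      ... | ()
      contradiction-on true e′ with trans (sym (≗⇒eqBits (π c) w λ t →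
                                   x⊕y≡false⇒x≡y (trans (cong (λ z → π c t xor (z ∧ w t)) (sym e′)) (πc≗βw t)))) πc≢w
      ... | ()

  π′≢0 : ∀ c → not (isZero (π′ c)) ≡ not (isZero (π c)) ∧ not (eqBits (π c) w)
  π′≢0 c = by-cases (isZero (π c)) (eqBits (π c) w) refl refl
    where
      by-cases : ∀ x y → isZero (π c) ≡ x → eqBits (π c) w ≡ y → not (isZero (π′ c)) ≡ not x ∧ not y
      by-cases true y e e′ = cong not (proj₁ (proj₂ (π≗0-case c e)))
      by-cases false true e e′ = cong not (proj₁ (proj₂ (π≗w-case c e′)))
      by-cases false false e e′ = cong not (π≢0,w-case c e e′)

-- λ_r = lamNum r / lamDen r
lamDen : ℕ → ℕ
lamDen zero = 1
lamDen (suc r) = 2 ^ suc r ∸ 1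

lamNum : ℕ → ℕ
lamNum zero = 0
lamNum (suc r) = suc r * 2 ^ r

lamDen-pos : ∀ r → 1 ≤ lamDen r
lamDen-pos zero = ≤-refl
lamDen-pos (suc r) = ∸-monoˡ-≤ 1 (+-mono-≤ (m^n>0 2 r) (≤-trans (m^n>0 2 r) (m≤m+n _ 0)))

2[PQ+QP]≤[P+Q]² : ∀ P Q → 2 * (P * Q + Q * P) ≤ (P + Q) * (P + Q)
2[PQ+QP]≤[P+Q]² P Q = [ ordered , (λ Q≤P → subst₂ _≤_ (cong (2 *_) (+-comm (Q * P) (P * Q))) (cong₂ _*_ (+-comm Q P) (+-comm Q P)) (ordered Q≤P)) ]′
                        (≤-total P Q)
  where
    ordered : ∀ {P Q} → P ≤ Q → 2 * (P * Q + Q * P) ≤ (P + Q) * (P + Q)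
    ordered {P} P≤Q with m≤n⇒∃[o]m+o≡n P≤Q
    ... | t , refl = subst (2 * (P * (P + t) + (P + t) * P) ≤_) square (m≤m+n _ (t * t))
      where
        open +-*-Solver
        square : 2 * (P * (P + t) + (P + t) * P) + t * t ≡ (P + (P + t)) * (P + (P + t))
        square = solve 2 (λ P t → con 2 :* (P :* (P :+ t) :+ (P :+ t) :* P) :+ t :* t := (P :+ (P :+ t)) :* (P :+ (P :+ t))) refl P t

-- Among the selected items, the ordered pairs with different labels number 2PQ ≤ (P + Q)²/2,
-- P and Q counting the selected items of either label.
disagreeing-pairs≤ : ∀ n (C f : Fin n → Bool) →
  2 * sumFin n (λ j′ → b2n (C j′) * sumFin n (λ j → b2n (C j) * b2n (f j xor f j′))) ≤ sumFin n (b2n ∘ C) * sumFin n (b2n ∘ C)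
disagreeing-pairs≤ n C f =
  subst₂ _≤_ (cong (2 *_) (sym pairs≡)) (sym (cong₂ _*_ size≡ size≡)) (2[PQ+QP]≤[P+Q]² P Q)
  where
    P Q : ℕ
    P = sumFin n (λ j → b2n (C j ∧ f j))
    Q = sumFin n (λ j → b2n (C j ∧ not (f j)))
    size≡ : sumFin n (b2n ∘ C) ≡ P + Q
    size≡ = trans (sumFin-cong n (λ j → split (C j) (f j))) (sumFin-+ n _ _)
      where split : ∀ c x → b2n c ≡ b2n (c ∧ x) + b2n (c ∧ not x)
            split true true = refl
            split true false = refl
            split false x = refl
    disagreeing : ∀ x → sumFin n (λ j → b2n (C j) * b2n (f j xor x)) ≡ (if x then Q else P)
    disagreeing true = sumFin-cong n (λ j → lemma (C j) (f j))
      where lemma : ∀ c y → b2n c * b2n (y xor true) ≡ b2n (c ∧ not y)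
            lemma true true = refl
            lemma true false = refl
            lemma false y = refl
    disagreeing false = sumFin-cong n (λ j → lemma (C j) (f j))
      where lemma : ∀ c y → b2n c * b2n (y xor false) ≡ b2n (c ∧ y)
            lemma true true = refl
            lemma true false = refl
            lemma false y = refl
    pairs≡ : sumFin n (λ j′ → b2n (C j′) * sumFin n (λ j → b2n (C j) * b2n (f j xor f j′))) ≡ P * Q + Q * P
    pairs≡ = trans (sumFin-cong n (λ j′ → trans (cong (b2n (C j′) *_) (disagreeing (f j′))) (lemma (C j′) (f j′))))
               (trans (sumFin-+ n _ _)
                 (cong₂ _+_ (trans (sumFin-cong n (λ j → *-comm (b2n (C j ∧ f j)) Q)) (trans (sumFin-*ˡ n Q _) (*-comm Q P)))
                            (trans (sumFin-cong n (λ j → *-comm (b2n (C j ∧ not (f j))) P)) (trans (sumFin-*ˡ n P _) (*-comm P Q)))))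
      where lemma : ∀ c y → b2n c * (if y then Q else P) ≡ b2n (c ∧ y) * Q + b2n (c ∧ not y) * P
            lemma true true = sym (+-identityʳ _)
            lemma true false = refl
            lemma false y = refl

n<2^n : ∀ s → suc s ≤ 2 ^ s
n<2^n zero = ≤-refl
n<2^n (suc s) = subst (_≤ 2 ^ suc s) (+-comm (suc s) 1) (+-mono-≤ (n<2^n s) (≤-trans (m^n>0 2 s) (m≤m+n (2 ^ s) 0)))

-- With D = lamDen (s+1), D′ = lamDen (s+2), Λ = lamNum (s+1), Λ′ = lamNum (s+2): b = 2Λ − D and
-- κ = 2(D Λ′ − D′ Λ) ≥ 1, the latter being λ_{s+2} > λ_{s+1}.
record LamIdentities (s : ℕ) : Set where
  field
    b κ : ℕ
    2Λ≡D+b : 2 * lamNum (suc s) ≡ lamDen (suc s) + b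
    D2Λ′≡D′[D+b]+κ : lamDen (suc s) * (2 * lamNum (suc (suc s))) ≡ lamDen (suc (suc s)) * (lamDen (suc s) + b) + κ
    κ+b≡DD′ : κ + b ≡ lamDen (suc s) * lamDen (suc (suc s))
    κ≥1 : 1 ≤ κ

lamIdentities : ∀ s → LamIdentities s
lamIdentities s with m≤n⇒∃[o]m+o≡n (n<2^n s)
... | t , s+1+t≡2^s = record { b = b ; κ = κ ; 2Λ≡D+b = 2Λ≡D+b ; D2Λ′≡D′[D+b]+κ = D2Λ′≡D′[D+b]+κ ; κ+b≡DD′ = κ+b≡DD′ ; κ≥1 = s≤s z≤n }
  where
    open +-*-Solver
    b = 2 * s * (s + t + 1) + 1
    κ = 2 + (6 * s * s + 14 * s * t + 8 * t * t + 8 * s + 10 * t)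
    2^s≡ : 2 ^ s ≡ suc s + t
    2^s≡ = sym s+1+t≡2^s
    D≡ : lamDen (suc s) ≡ 2 * (s + t) + 1
    D≡ = cong (_∸ 1) (trans (cong (λ q → q + (q + 0)) 2^s≡)
           (solve 2 (λ s t → (con 1 :+ s :+ t) :+ ((con 1 :+ s :+ t) :+ con 0) := con 1 :+ (con 2 :* (s :+ t) :+ con 1)) refl s t))
    D′≡ : lamDen (suc (suc s)) ≡ 4 * (s + t) + 3
    D′≡ = cong (_∸ 1) (trans (cong (λ q → (q + (q + 0)) + ((q + (q + 0)) + 0)) 2^s≡)
            (solve 2 (λ s t → ((con 1 :+ s :+ t) :+ ((con 1 :+ s :+ t) :+ con 0)) :+ (((con 1 :+ s :+ t) :+ ((con 1 :+ s :+ t) :+ con 0)) :+ con 0)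
                             := con 1 :+ (con 4 :* (s :+ t) :+ con 3)) refl s t))
    Λ≡ : lamNum (suc s) ≡ (s + 1) * (s + t + 1)
    Λ≡ = trans (cong (suc s *_) 2^s≡) (solve 2 (λ s t → (con 1 :+ s) :* (con 1 :+ s :+ t) := (s :+ con 1) :* (s :+ t :+ con 1)) refl s t)
    Λ′≡ : lamNum (suc (suc s)) ≡ (s + 2) * (2 * (s + t + 1))
    Λ′≡ = trans (cong (λ q → suc (suc s) * (q + (q + 0))) 2^s≡)
            (solve 2 (λ s t → (con 2 :+ s) :* ((con 1 :+ s :+ t) :+ ((con 1 :+ s :+ t) :+ con 0)) := (s :+ con 2) :* (con 2 :* (s :+ t :+ con 1))) refl s t)
    2Λ≡D+b : 2 * lamNum (suc s) ≡ lamDen (suc s) + b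
    2Λ≡D+b rewrite Λ≡ | D≡ =
      solve 2 (λ s t → con 2 :* ((s :+ con 1) :* (s :+ t :+ con 1)) := con 2 :* (s :+ t) :+ con 1 :+ (con 2 :* s :* (s :+ t :+ con 1) :+ con 1)) refl s t
    D2Λ′≡D′[D+b]+κ : lamDen (suc s) * (2 * lamNum (suc (suc s))) ≡ lamDen (suc (suc s)) * (lamDen (suc s) + b) + κ
    D2Λ′≡D′[D+b]+κ rewrite Λ′≡ | D≡ | D′≡ =
      solve 2 (λ s t → (con 2 :* (s :+ t) :+ con 1) :* (con 2 :* ((s :+ con 2) :* (con 2 :* (s :+ t :+ con 1))))
        := (con 4 :* (s :+ t) :+ con 3) :* (con 2 :* (s :+ t) :+ con 1 :+ (con 2 :* s :* (s :+ t :+ con 1) :+ con 1))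
           :+ (con 2 :+ (con 6 :* s :* s :+ con 14 :* s :* t :+ con 8 :* t :* t :+ con 8 :* s :+ con 10 :* t))) refl s t
    κ+b≡DD′ : κ + b ≡ lamDen (suc s) * lamDen (suc (suc s))
    κ+b≡DD′ rewrite D≡ | D′≡ =
      solve 2 (λ s t → con 2 :+ (con 6 :* s :* s :+ con 14 :* s :* t :+ con 8 :* t :* t :+ con 8 :* s :+ con 10 :* t) :+ (con 2 :* s :* (s :+ t :+ con 1) :+ con 1)
        := (con 2 :* (s :+ t) :+ con 1) :* (con 4 :* (s :+ t) :+ con 3)) refl s t

ℕ→ℚᵘ : ℕ → ℚᵘ
ℕ→ℚᵘ n = mkℚᵘ (ℤ.+ n) 0

toℚᵘ-toℚ : ∀ n → toℚᵘ (toℚ n) ≃ᵘ ℕ→ℚᵘ n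
toℚᵘ-toℚ n = ℚP.toℚᵘ-fromℚᵘ (ℕ→ℚᵘ n)

toℚ-+ : ∀ a b → toℚ (a + b) ≡ toℚ a +ℚ toℚ b
toℚ-+ a b = ℚP.toℚᵘ-injective (ℚᵘP.≃-trans (toℚᵘ-toℚ (a + b)) (ℚᵘP.≃-sym (ℚᵘP.≃-trans (ℚP.toℚᵘ-homo-+ (toℚ a) (toℚ b))
  (ℚᵘP.≃-trans (ℚᵘP.+-cong (toℚᵘ-toℚ a) (toℚᵘ-toℚ b)) (*≡* (cong (ℤ._* ℤ.+ 1) (sum≡ a b)))))))
  where
    open ℤ using (+_)
    open ℤ-Solver
    sum≡ : ∀ a b → + a ℤ.* + 1 ℤ.+ + b ℤ.* + 1 ≡ + (a + b)
    sum≡ a b = trans (solve 2 (λ a b → a :* con (+ 1) :+ b :* con (+ 1) := a :+ b) refl (+ a) (+ b)) (sym (ℤP.pos-+ a b))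

toℚ-* : ∀ a b → toℚ (a * b) ≡ toℚ a *ℚ toℚ b
toℚ-* a b = ℚP.toℚᵘ-injective (ℚᵘP.≃-trans (toℚᵘ-toℚ (a * b)) (ℚᵘP.≃-sym (ℚᵘP.≃-trans (ℚP.toℚᵘ-homo-* (toℚ a) (toℚ b))
  (ℚᵘP.≃-trans (ℚᵘP.*-cong (toℚᵘ-toℚ a) (toℚᵘ-toℚ b)) (*≡* (cong (ℤ._* ℤ.+ 1) (sym (ℤP.pos-* a b))))))))

toℚ-mono : ∀ {a b} → a ≤ b → toℚ a ≤ℚ toℚ b
toℚ-mono {a} {b} le = ℚP.toℚᵘ-cancel-≤ (ℚᵘP.≤-respˡ-≃ (ℚᵘP.≃-sym (toℚᵘ-toℚ a)) (ℚᵘP.≤-respʳ-≃ (ℚᵘP.≃-sym (toℚᵘ-toℚ b))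
  (*≤* (subst₂ ℤ._≤_ (sym (ℤP.*-identityʳ (ℤ.+ a))) (sym (ℤP.*-identityʳ (ℤ.+ b))) (+≤+ le)))))

toℚ-nonNeg : ∀ n → NonNegative (toℚ n)
toℚ-nonNeg n = nonNegative (toℚ-mono {0} {n} z≤n)

toℚ≤/ : ∀ e L m → e * suc m ≤ L → toℚ e ≤ℚ (ℤ.+ L / suc m)
toℚ≤/ e L m le = ℚP.toℚᵘ-cancel-≤ (ℚᵘP.≤-respˡ-≃ (ℚᵘP.≃-sym (toℚᵘ-toℚ e)) (ℚᵘP.≤-respʳ-≃ (ℚᵘP.≃-sym (ℚP.toℚᵘ-fromℚᵘ (mkℚᵘ (ℤ.+ L) m)))
  (*≤* (subst₂ ℤ._≤_ (ℤP.pos-* e (suc m)) (sym (ℤP.*-identityʳ (ℤ.+ L))) (+≤+ le)))))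

toℚ*1/ : ∀ D .{{_ : NonZero D}} → toℚ D *ℚ (ℤ.+ 1 / D) ≡ 1ℚ
toℚ*1/ (suc D) = ℚP.toℚᵘ-injective (ℚᵘP.≃-trans (ℚP.toℚᵘ-homo-* (toℚ (suc D)) (ℤ.+ 1 / suc D))
  (ℚᵘP.≃-trans (ℚᵘP.*-cong (toℚᵘ-toℚ (suc D)) (ℚP.toℚᵘ-fromℚᵘ (mkℚᵘ (ℤ.+ 1) D)))
    (*≡* (cong (λ z → ℤ.+ suc z) (trans (*-identityʳ (D * 1)) (trans (*-identityʳ D) (sym (trans (+-identityʳ _) (+-identityʳ D)))))))))

/2≡*½ : ∀ s → (ℤ.+ s / 2) ≡ toℚ s *ℚ ½
/2≡*½ s = ℚP.toℚᵘ-injective (ℚᵘP.≃-trans (ℚP.toℚᵘ-fromℚᵘ (mkℚᵘ (ℤ.+ s) 1))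
  (ℚᵘP.≃-sym (ℚᵘP.≃-trans (ℚP.toℚᵘ-homo-* (toℚ s) ½) (ℚᵘP.≃-trans (ℚᵘP.*-cong (toℚᵘ-toℚ s) (ℚP.toℚᵘ-fromℚᵘ (mkℚᵘ (ℤ.+ 1) 1)))
    (*≡* (cong (ℤ._* ℤ.+ 2) (ℤP.*-identityʳ (ℤ.+ s))))))))

lamDen*lam≡lamNum : ∀ r → toℚ (lamDen r) *ℚ lam r ≡ toℚ (lamNum r)
lamDen*lam≡lamNum zero = ℚP.*-zeroʳ (toℚ 1)
lamDen*lam≡lamNum (suc r) =
  begin
    d *ℚ ((ℤ.+ suc r / 2) *ℚ (1ℚ +ℚ x))
  ≡⟨ cong (λ z → d *ℚ (z *ℚ (1ℚ +ℚ x))) (/2≡*½ (suc r)) ⟩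
    d *ℚ ((s *ℚ ½) *ℚ (1ℚ +ℚ x))
  ≡⟨ solve 3 (λ d s x → d :* ((s :* con ½) :* (con 1ℚ :+ x)) := s :* con ½ :* (d :+ d :* x)) refl d s x ⟩
    s *ℚ ½ *ℚ (d +ℚ d *ℚ x)
  ≡⟨ cong (λ z → s *ℚ ½ *ℚ (d +ℚ z)) (toℚ*1/ D) ⟩
    s *ℚ ½ *ℚ (d +ℚ 1ℚ)
  ≡⟨ cong (λ z → s *ℚ ½ *ℚ z) (trans (sym (toℚ-+ D 1)) (trans (cong toℚ D+1≡2*2^r) (toℚ-* 2 (2 ^ r)))) ⟩
    s *ℚ ½ *ℚ (toℚ 2 *ℚ p)
  ≡⟨ solve 2 (λ s p → s :* con ½ :* (con (toℚ 2) :* p) := s :* p) refl s p ⟩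
    s *ℚ p
  ≡⟨ sym (toℚ-* (suc r) (2 ^ r)) ⟩
    toℚ (lamNum (suc r))
  ∎
  where
    open ≡-Reasoning
    open ℚ-Solver
    D = lamDen (suc r)
    instance
      D≢0 : NonZero D
      D≢0 = 2^r-1-nonZero r
    d = toℚ D
    s = toℚ (suc r)
    p = toℚ (2 ^ r)
    x = ℤ.+ 1 / D
    D+1≡2*2^r : D + 1 ≡ 2 * 2 ^ r
    D+1≡2*2^r = m∸n+n≡m {2 ^ suc r} {1} (+-mono-≤ (m^n>0 2 r) z≤n)

⟦_⟧ℚ : Expr → ℚ
⟦ ‵ n ⟧ℚ = toℚ n
⟦ a ⊞ b ⟧ℚ = ⟦ a ⟧ℚ +ℚ ⟦ b ⟧ℚ
⟦ a ⊠ b ⟧ℚ = ⟦ a ⟧ℚ *ℚ ⟦ b ⟧ℚ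

⟦⟧ℚ-homo : ∀ e → toℚ ⟦ e ⟧ℕ ≡ ⟦ e ⟧ℚ
⟦⟧ℚ-homo (‵ n) = refl
⟦⟧ℚ-homo (a ⊞ b) = trans (toℚ-+ ⟦ a ⟧ℕ ⟦ b ⟧ℕ) (cong₂ _+ℚ_ (⟦⟧ℚ-homo a) (⟦⟧ℚ-homo b))
⟦⟧ℚ-homo (a ⊠ b) = trans (toℚ-* ⟦ a ⟧ℕ ⟦ b ⟧ℕ) (cong₂ _*ℚ_ (⟦⟧ℚ-homo a) (⟦⟧ℚ-homo b))

sumFinℚ-suc : ∀ m (f : Fin (suc m) → ℚ) → sumFinℚ (suc m) f ≡ f zero +ℚ sumFinℚ m (f ∘ suc)
sumFinℚ-suc m f = cong (f zero +ℚ_) (trans (cong (foldr _ 0ℚ) (sym (map-tabulate id sucᶠ))) (foldr-map _ sucᶠ 0ℚ (tabulate id)))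
  where sucᶠ : Fin m → Fin (suc m)
        sucᶠ = suc

sumFinℚ-cong : ∀ s {f g : Fin s → ℚ} → f ≗ g → sumFinℚ s f ≡ sumFinℚ s g
sumFinℚ-cong zero eq = refl
sumFinℚ-cong (suc s) {f} {g} eq = trans (sumFinℚ-suc s f) (trans (cong₂ _+ℚ_ (eq zero) (sumFinℚ-cong s (eq ∘ suc))) (sym (sumFinℚ-suc s g)))

sumFinℚ-mono : ∀ s {f g : Fin s → ℚ} → (∀ i → f i ≤ℚ g i) → sumFinℚ s f ≤ℚ sumFinℚ s g
sumFinℚ-mono zero le = ℚP.≤-refl
sumFinℚ-mono (suc s) {f} {g} le =
  subst₂ _≤ℚ_ (sym (sumFinℚ-suc s f)) (sym (sumFinℚ-suc s g)) (ℚP.+-mono-≤ (le zero) (sumFinℚ-mono s (le ∘ suc)))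

toℚ-sumFin : ∀ s (g : Fin s → ℕ) → toℚ (sumFin s g) ≡ sumFinℚ s (toℚ ∘ g)
toℚ-sumFin zero g = refl
toℚ-sumFin (suc s) g = trans (cong toℚ (sumFin-suc s g))
  (trans (toℚ-+ (g zero) _) (trans (cong (toℚ (g zero) +ℚ_) (toℚ-sumFin s (g ∘ suc))) (sym (sumFinℚ-suc s (toℚ ∘ g)))))

sumFinℚ-*-+ : ∀ s (A B : Fin s → ℚ) (c : ℚ) → sumFinℚ s (λ i → A i *ℚ B i) +ℚ c *ℚ sumFinℚ s B ≡ sumFinℚ s (λ i → (A i +ℚ c) *ℚ B i)
sumFinℚ-*-+ zero A B c = trans (ℚP.+-identityˡ _) (ℚP.*-zeroʳ c)
sumFinℚ-*-+ (suc s) A B c =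
  begin
    sumFinℚ (suc s) (λ i → A i *ℚ B i) +ℚ c *ℚ sumFinℚ (suc s) B
  ≡⟨ cong₂ (λ x y → x +ℚ c *ℚ y) (sumFinℚ-suc s (λ i → A i *ℚ B i)) (sumFinℚ-suc s B) ⟩
    (A zero *ℚ B zero +ℚ X) +ℚ c *ℚ (B zero +ℚ Y)
  ≡⟨ solve 5 (λ a b c X Y → (a :* b :+ X) :+ c :* (b :+ Y) := (a :+ c) :* b :+ (X :+ c :* Y)) refl (A zero) (B zero) c X Y ⟩
    (A zero +ℚ c) *ℚ B zero +ℚ (X +ℚ c *ℚ Y)
  ≡⟨ cong ((A zero +ℚ c) *ℚ B zero +ℚ_) (sumFinℚ-*-+ s (A ∘ suc) (B ∘ suc) c) ⟩
    (A zero +ℚ c) *ℚ B zero +ℚ sumFinℚ s (λ i → (A (suc i) +ℚ c) *ℚ B (suc i))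
  ≡⟨ sym (sumFinℚ-suc s (λ i → (A i +ℚ c) *ℚ B i)) ⟩
    sumFinℚ (suc s) (λ i → (A i +ℚ c) *ℚ B i)
  ∎
  where
    open ≡-Reasoning
    open ℚ-Solver
    X = sumFinℚ s (λ i → A (suc i) *ℚ B (suc i))
    Y = sumFinℚ s (B ∘ suc)

*-mono-≤-nonNeg : ∀ {a a′ b b′ : ℚ} → .{{_ : NonNegative b}} → .{{_ : NonNegative a′}} → a ≤ℚ a′ → b ≤ℚ b′ → a *ℚ b ≤ℚ a′ *ℚ b′
*-mono-≤-nonNeg {a} {a′} {b} le₁ le₂ = ℚP.≤-trans (ℚP.*-monoʳ-≤-nonNeg b le₁) (ℚP.*-monoˡ-≤-nonNeg a′ le₂)

LinIndep-cong : ∀ {s k} {F G : Fin s → Bits k} → (∀ i → F i ≗ G i) → LinIndep F → LinIndep G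
LinIndep-cong eq li x h = li x (λ t → trans (lincomb-cong {x = x} eq (λ _ → refl) t) (h t))

LinIndep-inject≤ : ∀ {s t k} (F : Fin t → Bits k) (s≤t : s ≤ t) → LinIndep F → LinIndep (λ i → F (inject≤ i s≤t))
LinIndep-inject≤ {s} {t} F s≤t li with m≤n⇒m<n∨m≡n s≤t
... | inj₂ refl = LinIndep-cong (λ i t′ → cong (λ j → F j t′) (sym (inject≤-refl i s≤t))) li
LinIndep-inject≤ {s} {suc t} F s≤t li | inj₁ (s≤s s≤t′) =
  LinIndep-cong (λ i t′ → cong (λ j → F j t′) (toℕ-injective (trans (toℕ-inject₁ _) (trans (toℕ-inject≤ i s≤t′) (sym (toℕ-inject≤ i s≤t))))))
                (LinIndep-inject≤ (F ∘ inject₁) s≤t′ (LinIndep-init F li))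

quotient-of-independent : ∀ {k} s r → s + r ≡ k → (F : Fin s → Bits k) → LinIndep F → Quotient F r
quotient-of-independent zero r refl F li = Quotient-cong (λ ()) identityQuotient
quotient-of-independent (suc s) r eq F li =
  Quotient-cong (λ l → sym ∘ cong-app (snoc-η F l)) (Extension.extension q b p πb-p)
  where
    q = quotient-of-independent s (suc r) (trans (+-suc s r) eq) (F ∘ inject₁) (LinIndep-init F li)
    open Quotient q
    b = F (fromℕ s)
    πb≢0 : isZero (π b) ≡ false
    πb≢0 with isZero (π b) in πb≡0
    ... | false = refl
    ... | true = ⊥-elim (LinIndep-last∉span F li (φ b) (φ-coordinates b (λ i → sym (eqBits⇒≗ zeroBits (π b) πb≡0 i))))
    p = proj₁ (isZero≡false⇒∃true (π b) πb≢0)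
    πb-p = proj₂ (isZero≡false⇒∃true (π b) πb≢0)

module Bounds (d n k : ℕ) (A : Mat d n) (U : Mat d k) (V : Mat k n) (nn : Bits d → Fin n)
              (nn-nearest : (u : Bits d) (j : Fin n) → wt (col A (nn u) ⊕ u) ≤ wt (col A j ⊕ u)) where

  open Setup d n k A U V nn

  code : Fin n → Bits k
  code = col V

  loss : Fin n → ℕ
  loss j = wt (a j ⊕ (U ·v code j))

  nnDist : Bits k → ℕ
  nnDist b = wt (a (nn (U ·v b)) ⊕ (U ·v b))

  OPT≡sum-loss : OPT ≡ sumFin n loss
  OPT≡sum-loss = sumFin-swap d n (λ i j → b2n (A i j xor (U · V) i j))

  nnDist≤ : ∀ b j → nnDist b ≤ wt (a j ⊕ (U ·v b))
  nnDist≤ b j = nn-nearest (U ·v b) j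

  nnDist≤loss : ∀ {b} j → b ≗ code j → nnDist b ≤ loss j
  nnDist≤loss {b} j eq = ≤-trans (nnDist≤ b j) (≤-reflexive (wt-cong (λ i → cong (a j i xor_) (·v-cong U eq i))))

  Err≤representation : ∀ {m} (F : Fin m → Bits k) (X : Fin n → Bits m) → (∀ j → lincomb F (X j) ≗ code j) →
    Err F ≤ sumFin n (λ j → loss j + sumFin m (λ l → b2n (X j l) * nnDist (F l)))
  Err≤representation {m} F X represents with allMats-complete m n (λ l j → X j l)
  ... | Q , Q∈ , Q≗X =
    begin
      Err F
    ≤⟨ minL-≤ (λ Q → wtM (A ⊕M (AUB F · Q))) zeroMat Q∈ ⟩
      wtM (A ⊕M (AUB F · Q))
    ≡⟨ sumFin-swap d n _ ⟩
      sumFin n (λ j → sumFin d (λ i → b2n (A i j xor xorSum m (λ l → G l i ∧ Q l j))))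
    ≡⟨ sumFin-cong n (λ j → sumFin-cong d (λ i → cong (λ z → b2n (A i j xor z))
         (xorSum-cong m (λ l → trans (cong (G l i ∧_) (Q≗X l j)) (∧-comm (G l i) (X j l)))))) ⟩
      sumFin n (λ j → wt (a j ⊕ lincomb G (X j)))
    ≤⟨ sumFin-mono n column-bound ⟩
      sumFin n (λ j → loss j + sumFin m (λ l → b2n (X j l) * nnDist (F l)))
    ∎
    where
      open ≤-Reasoning
      G : Fin m → Bits d
      G l = a (nn (U ·v F l))
      column-bound : ∀ j → wt (a j ⊕ lincomb G (X j)) ≤ loss j + sumFin m (λ l → b2n (X j l) * nnDist (F l))
      column-bound j =
        begin
          wt (a j ⊕ lincomb G (X j))
        ≤⟨ wt-triangle (a j) (U ·v code j) (lincomb G (X j)) ⟩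
          loss j + wt ((U ·v code j) ⊕ lincomb G (X j))
        ≡⟨ cong (loss j +_) (wt-cong (λ i → cong (_xor lincomb G (X j) i)
             (trans (·v-cong U (λ t → sym (represents j t)) i) (·v-lincomb U F (X j) i)))) ⟩
          loss j + wt (lincomb (λ l → U ·v F l) (X j) ⊕ lincomb G (X j))
        ≤⟨ +-monoʳ-≤ (loss j) (wt-lincomb (λ l → U ·v F l) G (X j)) ⟩
          loss j + sumFin m (λ l → b2n (X j l) * wt ((U ·v F l) ⊕ G l))
        ≡⟨ cong (loss j +_) (sumFin-cong m (λ l → cong (b2n (X j l) *_) (wt-comm (U ·v F l) (G l)))) ⟩
          loss j + sumFin m (λ l → b2n (X j l) * nnDist (F l))
        ∎

  nnDistSum : ∀ {m} → (Fin m → Bits k) → ℕ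
  nnDistSum {m} bs = sumFin m (nnDist ∘ bs)

  coordCost : ∀ {m} → (Fin m → Bits k) → (Bits k → Bits m) → Bits k → ℕ
  coordCost {m} bs φ c = sumFin m (λ i → b2n (φ c i) * nnDist (bs i))

  module _ {m r} {bs : Fin m → Bits k} (q : Quotient bs r) where
    open Quotient q

    kernelCost : ℕ
    kernelCost = sumFin n (λ j → b2n (isZero (π (code j))) * coordCost bs φ (code j))

    outside : Fin n → Bool
    outside j = not (isZero (π (code j)))

    outsideCount : ℕ
    outsideCount = sumFin n (b2n ∘ outside)

    outsideLoss : ℕ
    outsideLoss = sumFin n (λ j → b2n (outside j) * loss j)

    coordCost-cong : ∀ {c c′} → c ≗ c′ → coordCost bs φ c ≡ coordCost bs φ c′
    coordCost-cong eq = sumFin-cong m (λ i → cong (λ x → b2n x * nnDist (bs i)) (φ-cong eq i))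

  -- The bound Err^(r) ≤ OPT + kernelCost + ½ outsideCount · nnDistSum + λ_r outsideLoss, cleared of denominators.
  ErrBound : ℕ → Set
  ErrBound r = ∀ {m} {bs : Fin m → Bits k} (q : Quotient bs r) →
    2 * lamDen r * ErrR r bs ≤ 2 * lamDen r * (OPT + kernelCost q) + lamDen r * (outsideCount q * nnDistSum bs) + 2 * lamNum r * outsideLoss q

  ErrBound-zero : ErrBound 0
  ErrBound-zero {m} {bs} q = ≤-trans (*-monoʳ-≤ (2 * 1) Err≤) (≤-trans (m≤m+n _ _) (m≤m+n _ _))
    where
      open Quotient q
      Err≤ : Err bs ≤ OPT + kernelCost q
      Err≤ = ≤-trans (Err≤representation bs (φ ∘ code) (λ j → φ-coordinates (code j) (λ ())))
        (≤-reflexive (trans (sumFin-+ n loss (λ j → coordCost bs φ (code j)))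
           (cong₂ _+_ (sym OPT≡sum-loss) (sumFin-cong n (λ j → sym (*-identityˡ _))))))

  module _ {m r} {bs : Fin m → Bits k} (q : Quotient bs (suc r)) where
    open Quotient q

    inCoset : Bits k → Fin n → Bool
    inCoset v j = eqBits (π (code j)) (π v)

    selectedCost : (Fin n → Bool) → (Fin n → ℕ) → ℕ
    selectedCost T cost = sumFin n (λ j → b2n (T j) * cost j)

    selectedCount remainingCount remainingLoss : (Fin n → Bool) → ℕ
    selectedCount T = sumFin n (b2n ∘ T)
    remainingCount T = sumFin n (λ j → b2n (outside q j ∧ not (T j)))
    remainingLoss T = sumFin n (λ j → b2n (outside q j ∧ not (T j)) * loss j)

    -- What adjoining a vector costs on top of 2 lamDen r (OPT + kernelCost q), when T selects the
    -- columns of its coset, cost j is the coordinate cost of column j relative to it and x is its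
    -- nearest-neighbour distance.
    costFor : (Fin n → Bool) → (Fin n → ℕ) → ℕ → ℕ
    costFor T cost x = 2 * lamDen r * (selectedCost T cost + selectedCount T * x) + lamDen r * (remainingCount T * (nnDistSum bs + x))
                       + 2 * lamNum r * remainingLoss T

    costFor-cong : ∀ {T T′ cost cost′} x → T ≗ T′ → cost ≗ cost′ → costFor T cost x ≡ costFor T′ cost′ x
    costFor-cong x eT ec = cong₃ (λ u v w → 2 * lamDen r * u + lamDen r * v + 2 * lamNum r * w)
      (cong₂ _+_ (sumFin-cong n (λ j → cong₂ (λ t c → b2n t * c) (eT j) (ec j))) (cong (_* x) (sumFin-cong n (cong b2n ∘ eT))))
      (cong (_* (nnDistSum bs + x)) (sumFin-cong n (λ j → cong (λ t → b2n (outside q j ∧ not t)) (eT j))))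
      (sumFin-cong n (λ j → cong (λ t → b2n (outside q j ∧ not t) * loss j) (eT j)))

    costFor-mono : ∀ T cost {x x′} → x ≤ x′ → costFor T cost x ≤ costFor T cost x′
    costFor-mono T cost le =
      +-monoˡ-≤ _ (+-mono-≤ (*-monoʳ-≤ (2 * lamDen r) (+-monoʳ-≤ (selectedCost T cost) (*-monoʳ-≤ (selectedCount T) le)))
                            (*-monoʳ-≤ (lamDen r) (*-monoʳ-≤ (remainingCount T) (+-monoʳ-≤ (nnDistSum bs) le))))

    extensionCost : Bits k → ℕ → ℕ
    extensionCost v = costFor (inCoset v) (λ j → coordCost bs φ (code j ⊕ v))

  module ExtensionCosts {m r} {bs : Fin m → Bits k} (q : Quotient bs (suc r))
                        (b : Bits k) (p : Fin (suc r)) (πb-p : Quotient.π q b p ≡ true) where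
    open Quotient q
    open Extension q b p πb-p

    coordCost-extension : ∀ c → coordCost bs′ φ′ c ≡ coordCost bs φ (reduce c) + b2n (β c) * nnDist b
    coordCost-extension c = trans (sumFin-last m _)
      (cong₂ _+_ (sumFin-cong m (λ i → cong₂ (λ x y → b2n x * nnDist y) (snoc-inject₁ (φ (reduce c)) (β c) i) (snoc-inject₁ bs b i)))
                 (cong₂ (λ x y → b2n x * nnDist y) (snoc-last (φ (reduce c)) (β c)) (snoc-last bs b)))

    nnDistSum-extension : nnDistSum bs′ ≡ nnDistSum bs + nnDist b
    nnDistSum-extension = trans (sumFin-last m _) (cong₂ _+_ (sumFin-cong m (λ i → cong nnDist (snoc-inject₁ bs b i))) (cong nnDist (snoc-last bs b)))

    Tb : Fin n → Bool
    Tb = inCoset q b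

    costb : Fin n → ℕ
    costb j = coordCost bs φ (code j ⊕ b)

    column-kernelCost : ∀ c → b2n (isZero (π′ c)) * coordCost bs′ φ′ c
                              ≡ b2n (isZero (π c)) * coordCost bs φ c + b2n (eqBits (π c) w) * (coordCost bs φ (c ⊕ b) + nnDist b)
    column-kernelCost c = by-cases (isZero (π c)) (eqBits (π c) w) refl refl
      where
        by-cases : ∀ x y → isZero (π c) ≡ x → eqBits (π c) w ≡ y →
          b2n (isZero (π′ c)) * coordCost bs′ φ′ c ≡ b2n x * coordCost bs φ c + b2n y * (coordCost bs φ (c ⊕ b) + nnDist b)
        by-cases true true e e′ with trans (sym e′) (proj₁ (π≗0-case c e))
        ... | ()
        by-cases true false e e′ with π≗0-case c e
        ... | _ , π′c≡0 , βc≡false rewrite π′c≡0 | coordCost-extension c | βc≡false =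
          cong (λ z → z + 0 + 0) (coordCost-cong q (λ t → xor-identityʳ (c t)))
        by-cases false true e e′ with π≗w-case c e′
        ... | _ , π′c≡0 , βc≡true rewrite π′c≡0 | coordCost-extension c | βc≡true =
          cong (_+ 0) (cong₂ _+_ (coordCost-cong q (λ _ → refl)) (+-identityʳ _))
        by-cases false false e e′ rewrite π≢0,w-case c e e′ = refl

    kernelCost-extension : kernelCost extension ≡ kernelCost q + (selectedCost q Tb costb + selectedCount q Tb * nnDist b)
    kernelCost-extension =
      begin
        kernelCost extension
      ≡⟨ trans (sumFin-cong n (column-kernelCost ∘ code)) (sumFin-+ n _ _) ⟩
        kernelCost q + sumFin n (λ j → b2n (inCoset q b j) * (coordCost bs φ (code j ⊕ b) + nnDist b))
      ≡⟨ cong (kernelCost q +_) (trans (sumFin-cong n (λ j → *-distribˡ-+ (b2n (inCoset q b j)) _ (nnDist b))) (sumFin-+ n _ _)) ⟩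
        kernelCost q + (selectedCost q Tb costb + sumFin n (λ j → b2n (inCoset q b j) * nnDist b))
      ≡⟨ cong (λ z → kernelCost q + (selectedCost q Tb costb + z))
           (trans (sumFin-cong n (λ j → *-comm (b2n (inCoset q b j)) (nnDist b))) (trans (sumFin-*ˡ n (nnDist b) _) (*-comm (nnDist b) _))) ⟩
        kernelCost q + (selectedCost q Tb costb + selectedCount q Tb * nnDist b)
      ∎
      where open ≡-Reasoning

    outsideCount-extension : outsideCount extension ≡ remainingCount q Tb
    outsideCount-extension = sumFin-cong n (λ j → cong b2n (π′≢0 (code j)))

    outsideLoss-extension : outsideLoss extension ≡ remainingLoss q Tb
    outsideLoss-extension = sumFin-cong n (λ j → cong (λ x → b2n x * loss j) (π′≢0 (code j)))

  Err-extension : ∀ {m r} {bs : Fin m → Bits k} (q : Quotient bs (suc r)) {b : Bits k} → b ∈ allBits k →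
    ∀ p → Quotient.π q b p ≡ true → ErrBound r →
    2 * lamDen r * ErrR (suc r) bs ≤ 2 * lamDen r * (OPT + kernelCost q) + extensionCost q b (nnDist b)
  Err-extension {m} {r} {bs} q {b} b∈ p πb-p IH =
    begin
      2 * D * ErrR (suc r) bs
    ≤⟨ *-monoʳ-≤ (2 * D) (minL-≤ (λ b′ → ErrR r (snoc bs b′)) zeroBits b∈) ⟩
      2 * D * ErrR r bs′
    ≤⟨ IH extension ⟩
      2 * D * (OPT + kernelCost extension) + D * (outsideCount extension * nnDistSum bs′) + 2 * Λ * outsideLoss extension
    ≡⟨ cong₃ (λ x y z → 2 * D * (OPT + x) + D * y + 2 * Λ * z)
         kernelCost-extension (cong₂ _*_ outsideCount-extension nnDistSum-extension) outsideLoss-extension ⟩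
      2 * D * (OPT + (K + (P + N * e))) + D * (R * (E + e)) + 2 * Λ * remainingLoss q Tb
    ≡⟨ solve 6 (λ D O K X Y Z → con 2 :* D :* (O :+ (K :+ X)) :+ D :* Y :+ Z
                  := con 2 :* D :* (O :+ K) :+ (con 2 :* D :* X :+ D :* Y :+ Z)) refl D OPT K (P + N * e) (R * (E + e)) (2 * Λ * remainingLoss q Tb) ⟩
      2 * D * (OPT + kernelCost q) + extensionCost q b e
    ∎
    where
      open ≤-Reasoning
      open +-*-Solver
      open Extension q b p πb-p
      open ExtensionCosts q b p πb-p
      D = lamDen r
      Λ = lamNum r
      K = kernelCost q
      P = selectedCost q Tb costb
      N = selectedCount q Tb
      R = remainingCount q Tb
      E = nnDistSum bs
      e = nnDist b

  module Cosets {m r} {bs : Fin m → Bits k} (q : Quotient bs (suc r)) where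
    open Quotient q

    D D′ Λ Λ′ E NY LY : ℕ
    D = lamDen r
    D′ = lamDen (suc r)
    Λ = lamNum r
    Λ′ = lamNum (suc r)
    E = nnDistSum bs
    NY = outsideCount q
    LY = outsideLoss q

    inCosetOf : Bits (suc r) → Fin n → Bool
    inCosetOf y j = eqBits (π (code j)) y

    cosetSize cosetLoss restCount restLoss : Bits (suc r) → ℕ
    cosetSize y = selectedCount q (inCosetOf y)
    cosetLoss y = selectedCost q (inCosetOf y) loss
    restCount y = remainingCount q (inCosetOf y)
    restLoss y = remainingLoss q (inCosetOf y)

    pairCost : Bits (suc r) → Fin n → ℕ
    pairCost y j′ = selectedCost q (inCosetOf y) (λ j → coordCost bs φ (code j ⊕ code j′))

    columnCost : Fin n → ℕ
    columnCost j′ = extensionCost q (code j′) (loss j′)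

    -- Adjoining the code of a column j′ with D′ · columnCost j′ ≤ budget establishes ErrBound (suc r) for q.
    budget : ℕ
    budget = D * (D′ * (NY * E) + 2 * Λ′ * LY)

    AllTooExpensive : Set
    AllTooExpensive = ∀ j′ → outside q j′ ≡ true → budget < D′ * columnCost j′

    columnCost≡ : ∀ y j′ → π (code j′) ≗ y →
      columnCost j′ ≡ 2 * D * (pairCost y j′ + cosetSize y * loss j′) + D * (restCount y * (E + loss j′)) + 2 * Λ * restLoss y
    columnCost≡ y j′ πj′≗y = costFor-cong q (loss j′) (λ j → eqBits-cong {u = π (code j)} (λ _ → refl) πj′≗y) (λ _ → refl)

    outside-split : ∀ y → isZero y ≡ false → ∀ j → b2n (outside q j) ≡ b2n (inCosetOf y j) + b2n (outside q j ∧ not (inCosetOf y j))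
    outside-split y y≢0 j with inCosetOf y j in e
    ... | true rewrite trans (eqBits-cong {u = zeroBits} {v = π (code j)} (λ _ → refl) (eqBits⇒≗ (π (code j)) y e)) y≢0 = refl
    ... | false = cong b2n (sym (∧-identityʳ (outside q j)))

    outsideCount-split : ∀ y → isZero y ≡ false → NY ≡ cosetSize y + restCount y
    outsideCount-split y y≢0 = trans (sumFin-cong n (outside-split y y≢0)) (sumFin-+ n _ _)

    outsideLoss-split : ∀ y → isZero y ≡ false → LY ≡ cosetLoss y + restLoss y
    outsideLoss-split y y≢0 = trans (sumFin-cong n (λ j → trans (cong (_* loss j) (outside-split y y≢0 j))
                                                                  (*-distribʳ-+ (loss j) (b2n (inCosetOf y j)) _))) (sumFin-+ n _ _)

    cosetPairCost : Bits (suc r) → ℕ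
    cosetPairCost y = selectedCost q (inCosetOf y) (pairCost y)

    disagreements : Bits (suc r) → Fin m → ℕ
    disagreements y i = sumFin n (λ j′ → b2n (inCosetOf y j′) * sumFin n (λ j → b2n (inCosetOf y j) * b2n (φ (code j) i xor φ (code j′) i)))

    cosetPairCost≡ : ∀ y → cosetPairCost y ≡ sumFin m (λ i → nnDist (bs i) * disagreements y i)
    cosetPairCost≡ y =
      begin
        cosetPairCost y
      ≡⟨ sumFin-cong n (λ j′ → trans (cong (b2n (C j′) *_) (trans (sumFin-cong n (λ j → trans (cong (b2n (C j) *_)
             (sumFin-cong m (λ i → cong (λ x → b2n x * nnDist (bs i)) (φ-linear (code j) (code j′) i)))) (sym (sumFin-*ˡ m (b2n (C j)) _))))
             (sumFin-swap n m _))) (sym (sumFin-*ˡ m (b2n (C j′)) _))) ⟩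
        sumFin n (λ j′ → sumFin m (λ i → b2n (C j′) * sumFin n (λ j → b2n (C j) * (b2n (φ (code j) i xor φ (code j′) i) * nnDist (bs i)))))
      ≡⟨ sumFin-swap n m _ ⟩
        sumFin m (λ i → sumFin n (λ j′ → b2n (C j′) * sumFin n (λ j → b2n (C j) * (b2n (φ (code j) i xor φ (code j′) i) * nnDist (bs i)))))
      ≡⟨ sumFin-cong m (λ i → trans (sumFin-cong n (λ j′ → trans (cong (b2n (C j′) *_)
           (trans (sumFin-cong n (λ j → rotate (b2n (C j)) _ (nnDist (bs i)))) (sumFin-*ˡ n (nnDist (bs i)) _)))
           (*-left-comm (b2n (C j′)) (nnDist (bs i)) _))) (sumFin-*ˡ n (nnDist (bs i)) _)) ⟩
        sumFin m (λ i → nnDist (bs i) * disagreements y i)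
      ∎
      where
        open ≡-Reasoning
        C = inCosetOf y
        rotate : ∀ a b c → a * (b * c) ≡ c * (a * b)
        rotate a b c = trans (sym (*-assoc a b c)) (*-comm (a * b) c)

    cosetPairCost≤ : ∀ y → 2 * cosetPairCost y ≤ cosetSize y * cosetSize y * E
    cosetPairCost≤ y =
      begin
        2 * cosetPairCost y
      ≡⟨ cong (2 *_) (cosetPairCost≡ y) ⟩
        2 * sumFin m (λ i → nnDist (bs i) * disagreements y i)
      ≡⟨ trans (sym (sumFin-*ˡ m 2 _)) (sumFin-cong m (λ i → *-left-comm 2 (nnDist (bs i)) (disagreements y i))) ⟩
        sumFin m (λ i → nnDist (bs i) * (2 * disagreements y i))
      ≤⟨ sumFin-mono m (λ i → *-monoʳ-≤ (nnDist (bs i)) (disagreeing-pairs≤ n (inCosetOf y) (λ j → φ (code j) i))) ⟩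
        sumFin m (λ i → nnDist (bs i) * (cosetSize y * cosetSize y))
      ≡⟨ trans (sumFin-cong m (λ i → *-comm (nnDist (bs i)) _)) (sumFin-*ˡ m (cosetSize y * cosetSize y) _) ⟩
        cosetSize y * cosetSize y * E
      ∎
      where open ≤-Reasoning

    module _ (too-expensive : AllTooExpensive) (y : Bits (suc r)) (y≢0 : isZero y ≡ false) where

      private
        C = inCosetOf y
        N = cosetSize y
        L = cosetLoss y
        Nᶜ = restCount y
        Lᶜ = restLoss y

        weighted : Fin n → ℕ
        weighted j′ = 2 * D * (b2n (C j′) * pairCost y j′) + (2 * D * N + D * Nᶜ) * (b2n (C j′) * loss j′) + (D * Nᶜ * E + 2 * Λ * Lᶜ) * b2n (C j′)

        column-fails : ∀ j′ → b2n (C j′) * suc budget ≤ D′ * weighted j′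
        column-fails j′ with C j′ in e
        ... | false = z≤n
        ... | true = ≤-trans (≤-reflexive (*-identityˡ (suc budget)))
                       (≤-trans (too-expensive j′ outside-j′) (≤-reflexive (cong (D′ *_) (trans (columnCost≡ y j′ πj′≗y) rearrange))))
          where
            open +-*-Solver
            πj′≗y : π (code j′) ≗ y
            πj′≗y = eqBits⇒≗ (π (code j′)) y e
            outside-j′ : outside q j′ ≡ true
            outside-j′ rewrite trans (eqBits-cong {u = zeroBits} {v = π (code j′)} (λ _ → refl) πj′≗y) y≢0 = refl
            rearrange : 2 * D * (pairCost y j′ + N * loss j′) + D * (Nᶜ * (E + loss j′)) + 2 * Λ * Lᶜ
                        ≡ 2 * D * (1 * pairCost y j′) + (2 * D * N + D * Nᶜ) * (1 * loss j′) + (D * Nᶜ * E + 2 * Λ * Lᶜ) * 1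
            rearrange = solve 8 (λ D P N l Nc E Λ Lc → con 2 :* D :* (P :+ N :* l) :+ D :* (Nc :* (E :+ l)) :+ con 2 :* Λ :* Lc
                   := con 2 :* D :* (con 1 :* P) :+ (con 2 :* D :* N :+ D :* Nc) :* (con 1 :* l) :+ (D :* Nc :* E :+ con 2 :* Λ :* Lc) :* con 1)
                   refl D (pairCost y j′) N (loss j′) Nᶜ E Λ Lᶜ

        sum-weighted : sumFin n weighted ≡ 2 * D * cosetPairCost y + (2 * D * N + D * Nᶜ) * L + (D * Nᶜ * E + 2 * Λ * Lᶜ) * N
        sum-weighted = trans (sumFin-+ n _ _) (cong₂ _+_ (trans (sumFin-+ n _ _) (cong₂ _+_ (sumFin-*ˡ n (2 * D) _)
                         (sumFin-*ˡ n (2 * D * N + D * Nᶜ) (λ j → b2n (C j) * loss j)))) (sumFin-*ˡ n (D * Nᶜ * E + 2 * Λ * Lᶜ) (b2n ∘ C)))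

      -- Summing the failures over the coset y, with the pair costs bounded by cosetPairCost≤;
      -- the nearest-neighbour terms cancel.
      failing-coset : N * (D * (2 * Λ′)) * (L + Lᶜ) + N ≤ D′ * (2 * D * N * L + D * Nᶜ * L + 2 * Λ * N * Lᶜ)
      failing-coset = +-cancelˡ-≤ X _ _ (≤-trans (≤-reflexive (trans lhs≡ (cong (λ z → N * suc z) (sym budget≡))))
                                         (≤-trans summed (≤-reflexive rhs≡)))
        where
          open +-*-Solver
          X = D′ * D * (N * (N + Nᶜ) * E)
          budget≡ : budget ≡ D * (D′ * ((N + Nᶜ) * E) + 2 * Λ′ * (L + Lᶜ))
          budget≡ = cong₂ (λ a b → D * (D′ * (a * E) + 2 * Λ′ * b)) (outsideCount-split y y≢0) (outsideLoss-split y y≢0)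
          summed : N * suc budget ≤ D′ * (D * (N * N * E) + (2 * D * N + D * Nᶜ) * L + (D * Nᶜ * E + 2 * Λ * Lᶜ) * N)
          summed =
            begin
              N * suc budget
            ≡⟨ trans (*-comm N (suc budget)) (trans (sym (sumFin-*ˡ n (suc budget) (b2n ∘ C))) (sumFin-cong n (λ j → *-comm (suc budget) _))) ⟩
              sumFin n (λ j′ → b2n (C j′) * suc budget)
            ≤⟨ sumFin-mono n column-fails ⟩
              sumFin n (λ j′ → D′ * weighted j′)
            ≡⟨ trans (sumFin-*ˡ n D′ weighted) (cong (D′ *_) sum-weighted) ⟩
              D′ * (2 * D * cosetPairCost y + (2 * D * N + D * Nᶜ) * L + (D * Nᶜ * E + 2 * Λ * Lᶜ) * N)
            ≤⟨ *-monoʳ-≤ D′ (+-monoˡ-≤ _ (+-monoˡ-≤ _ (≤-trans (≤-reflexive (trans (cong (_* cosetPairCost y) (*-comm 2 D)) (*-assoc D 2 _))) (*-monoʳ-≤ D (cosetPairCost≤ y))))) ⟩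
              D′ * (D * (N * N * E) + (2 * D * N + D * Nᶜ) * L + (D * Nᶜ * E + 2 * Λ * Lᶜ) * N)
            ∎
            where open ≤-Reasoning
          lhs≡ : X + (N * (D * (2 * Λ′)) * (L + Lᶜ) + N) ≡ N * suc (D * (D′ * ((N + Nᶜ) * E) + 2 * Λ′ * (L + Lᶜ)))
          lhs≡ = solve 8 (λ D D′ Λ′ N Nᶜ L Lᶜ E → D′ :* D :* (N :* (N :+ Nᶜ) :* E) :+ (N :* (D :* (con 2 :* Λ′)) :* (L :+ Lᶜ) :+ N)
                   := N :* (con 1 :+ D :* (D′ :* ((N :+ Nᶜ) :* E) :+ con 2 :* Λ′ :* (L :+ Lᶜ)))) refl D D′ Λ′ N Nᶜ L Lᶜ E
          rhs≡ : D′ * (D * (N * N * E) + (2 * D * N + D * Nᶜ) * L + (D * Nᶜ * E + 2 * Λ * Lᶜ) * N) ≡ X + D′ * (2 * D * N * L + D * Nᶜ * L + 2 * Λ * N * Lᶜ)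
          rhs≡ = solve 8 (λ D D′ Λ N Nᶜ L Lᶜ E → D′ :* (D :* (N :* N :* E) :+ (con 2 :* D :* N :+ D :* Nᶜ) :* L :+ (D :* Nᶜ :* E :+ con 2 :* Λ :* Lᶜ) :* N)
                   := D′ :* D :* (N :* (N :+ Nᶜ) :* E) :+ D′ :* (con 2 :* D :* N :* L :+ D :* Nᶜ :* L :+ con 2 :* Λ :* N :* Lᶜ)) refl D D′ Λ N Nᶜ L Lᶜ E

    nonzero : Bits (suc r) → ℕ
    nonzero y = b2n (not (isZero y))

    nonzero-cong : ∀ {y y′} → y ≗ y′ → nonzero y ≡ nonzero y′
    nonzero-cong eq = cong (λ x → b2n (not x)) (eqBits-cong {u = zeroBits} (λ _ → refl) eq)

    Σ-nonzero*cosetSize : sumL (λ y → nonzero y * cosetSize y) (allBits (suc r)) ≡ NY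
    Σ-nonzero*cosetSize =
      trans (sumL-cong (allBits (suc r)) (λ y → sym (sumFin-*ˡ n (nonzero y) _)))
        (trans (sumL-sumFin n _ (allBits (suc r)))
          (sumFin-cong n (λ j → trans (sumL-cong (allBits (suc r)) (λ y → trans (*-comm (nonzero y) _) (b2n-* (inCosetOf y j) (nonzero y))))
                                     (sumL-allBits-point (suc r) (π (code j)) nonzero nonzero-cong))))

    Σ-nonzero*cosetLoss : sumL (λ y → nonzero y * cosetLoss y) (allBits (suc r)) ≡ LY
    Σ-nonzero*cosetLoss =
      trans (sumL-cong (allBits (suc r)) (λ y → sym (sumFin-*ˡ n (nonzero y) _)))
        (trans (sumL-sumFin n _ (allBits (suc r)))
          (sumFin-cong n (λ j → trans (sumL-cong (allBits (suc r)) (λ y → trans (*-left-comm (nonzero y) (b2n (inCosetOf y j)) (loss j))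
                                                                                (b2n-* (inCosetOf y j) (nonzero y * loss j))))
                                     (sumL-allBits-point (suc r) (π (code j)) (λ y → nonzero y * loss j) (cong (_* loss j) ∘ nonzero-cong)))))

    Σ-nonzero : sumL nonzero (allBits (suc r)) ≡ D′
    Σ-nonzero = trans (sym (m+n∸n≡m (sumL nonzero (allBits (suc r))) 1))
      (cong (_∸ 1) (trans (cong (sumL nonzero (allBits (suc r)) +_) (sym one-zero))
        (trans (sym (sumL-+ nonzero (b2n ∘ isZero) (allBits (suc r))))
          (trans (sumL-cong (allBits (suc r)) (λ y → not+id (isZero y))) (sumL-allBits-1 (suc r))))))
      where
        not+id : ∀ x → b2n (not x) + b2n x ≡ 1
        not+id true = refl
        not+id false = refl
        one-zero : sumL (b2n ∘ isZero) (allBits (suc r)) ≡ 1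
        one-zero = trans (sumL-cong (allBits (suc r)) (λ y → trans (sym (*-identityʳ (b2n (isZero y)))) (b2n-* (isZero y) 1)))
                         (sumL-allBits-point (suc r) zeroBits (λ _ → 1) (λ _ → refl))

  -- The failure inequalities of the nonzero cosets, made linear in the coset data by
  -- polynomial-inequality, sum up to κ · outsideCount q ≤ 0.
  all-too-expensive-impossible-suc : ∀ {m s} {bs : Fin m → Bits k} (q : Quotient bs (suc (suc s))) →
    1 ≤ outsideCount q → ¬ Cosets.AllTooExpensive q
  all-too-expensive-impossible-suc {m} {s} q NY≥1 too-expensive = 1≰0 (≤-trans (*-mono-≤ κ≥1 NY≥1) κNY≤0)
    where
      open Cosets q
      open LamIdentities (lamIdentities s)
      open +-*-Solver
      M = D′
      α = D * LY * D * (M * M)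
      β = D * M * NY * κ
      γ = D * LY * b * NY
      1≰0 : ¬ 1 ≤ 0
      1≰0 ()
      per-coset : ∀ N L Nᶜ Lᶜ → NY ≡ N + Nᶜ → LY ≡ L + Lᶜ →
        N * (D * (2 * Λ′)) * (L + Lᶜ) + N ≤ D′ * (2 * D * N * L + D * Nᶜ * L + 2 * Λ * N * Lᶜ) → (α + κ) * N ≤ β * L + γ
      per-coset zero L Nᶜ Lᶜ _ _ _ = ≤-trans (≤-reflexive (*-zeroʳ (α + κ))) z≤n
      per-coset N@(suc _) L Nᶜ Lᶜ NY≡ LY≡ failing =
        subst₂ _≤_ (solve 5 (λ D LY M N κ → D :* LY :* D :* (M :* M) :* N :+ κ :* N := (D :* LY :* D :* (M :* M) :+ κ) :* N) refl D LY M N κ)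
                   (solve 7 (λ D M NY κ L LY b → D :* (M :* NY :* κ :* L :+ LY :* b :* NY) := D :* M :* NY :* κ :* L :+ D :* LY :* b :* NY) refl D M NY κ L LY b)
          (subst₂ (λ ny ly → D * ly * D * (M * M) * N + κ * N ≤ D * (M * ny * κ * L + ly * b * ny)) (sym NY≡) (sym LY≡)
            (polynomial-inequality D M b κ N L Nᶜ Lᶜ κ+b≡DD′ (s≤s z≤n)
              (subst₂ (λ x y → N * x * (L + Lᶜ) + N ≤ M * (2 * D * N * L + D * Nᶜ * L + y * N * Lᶜ)) D2Λ′≡D′[D+b]+κ 2Λ≡D+b failing)))
      coset-bound : ∀ y → nonzero y * ((α + κ) * cosetSize y) ≤ nonzero y * (β * cosetLoss y + γ)
      coset-bound y with isZero y in y≢0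
      ... | true = z≤n
      ... | false = *-monoʳ-≤ 1 (per-coset (cosetSize y) (cosetLoss y) (restCount y) (restLoss y)
                                  (outsideCount-split y y≢0) (outsideLoss-split y y≢0) (failing-coset too-expensive y y≢0))
      summed : (α + κ) * NY ≤ β * LY + γ * M
      summed = subst₂ _≤_
        (trans (sumL-cong (allBits (suc (suc s))) (λ y → *-left-comm (nonzero y) (α + κ) (cosetSize y)))
               (trans (sumL-*ˡ (α + κ) _ (allBits (suc (suc s)))) (cong ((α + κ) *_) Σ-nonzero*cosetSize)))
        (trans (sumL-cong (allBits (suc (suc s))) (λ y → solve 4 (λ w B L C → w :* (B :* L :+ C) := B :* (w :* L) :+ C :* w) refl (nonzero y) β (cosetLoss y) γ))
               (trans (sumL-+ _ _ (allBits (suc (suc s))))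
                 (cong₂ _+_ (trans (sumL-*ˡ β _ (allBits (suc (suc s)))) (cong (β *_) Σ-nonzero*cosetLoss))
                            (trans (sumL-*ˡ γ _ (allBits (suc (suc s)))) (cong (γ *_) Σ-nonzero)))))
        (sumL-mono (allBits (suc (suc s))) coset-bound)
      β+γ≡α : β * LY + γ * M ≡ α * NY + 0
      β+γ≡α = trans (solve 6 (λ D M NY κ LY b → D :* M :* NY :* κ :* LY :+ D :* LY :* b :* NY :* M := D :* M :* NY :* LY :* (κ :+ b)) refl D M NY κ LY b)
               (trans (cong (λ x → D * M * NY * LY * x) κ+b≡DD′)
                 (solve 4 (λ D M NY LY → D :* M :* NY :* LY :* (D :* M) := D :* LY :* D :* (M :* M) :* NY :+ con 0) refl D M NY LY))
      κNY≤0 : κ * NY ≤ 0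
      κNY≤0 = +-cancelˡ-≤ (α * NY) _ _ (≤-trans (≤-reflexive (sym (*-distribʳ-+ NY α κ))) (≤-trans summed (≤-reflexive β+γ≡α)))

  all-too-expensive-impossible-zero : ∀ {m} {bs : Fin m → Bits k} (q : Quotient bs 1) →
    1 ≤ outsideCount q → ¬ Cosets.AllTooExpensive q
  all-too-expensive-impossible-zero q NY≥1 too-expensive = 1≰0 (≤-trans (subst (1 ≤_) NY≡N NY≥1) N≤0)
    where
      open Quotient q
      open Cosets q
      open +-*-Solver
      1≰0 : ¬ 1 ≤ 0
      1≰0 ()
      ones : Bits 1
      ones _ = true
      rest-empty : ∀ (u : Bits 1) → not (isZero u) ∧ not (eqBits u ones) ≡ false
      rest-empty u rewrite eqBits-suc zeroBits u | eqBits-suc u ones = by-cases (u zero)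
        where by-cases : ∀ x → not (not (false xor x) ∧ true) ∧ not (not (x xor true) ∧ true) ≡ false
              by-cases true = refl
              by-cases false = refl
      Nᶜ≡0 : restCount ones ≡ 0
      Nᶜ≡0 = trans (sumFin-cong n (λ j → cong b2n (rest-empty (π (code j))))) (sumFin-zero n)
      Lᶜ≡0 : restLoss ones ≡ 0
      Lᶜ≡0 = trans (sumFin-cong n (λ j → cong (λ x → b2n x * loss j) (rest-empty (π (code j))))) (sumFin-zero n)
      N = cosetSize ones
      L = cosetLoss ones
      NY≡N : NY ≡ N
      NY≡N = trans (outsideCount-split ones refl) (trans (cong (N +_) Nᶜ≡0) (+-identityʳ N))
      failing : N * (1 * (2 * 1)) * (L + 0) + N ≤ 1 * (2 * 1 * N * L + 1 * 0 * L + 2 * 0 * N * 0)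
      failing = subst₂ (λ a b → N * (1 * (2 * 1)) * (L + b) + N ≤ 1 * (2 * 1 * N * L + 1 * a * L + 2 * 0 * N * b)) Nᶜ≡0 Lᶜ≡0
                  (failing-coset too-expensive ones refl)
      N≤0 : N ≤ 0
      N≤0 = +-cancelˡ-≤ (2 * N * L) _ _ (subst₂ _≤_
              (solve 2 (λ N L → N :* (con 1 :* (con 2 :* con 1)) :* (L :+ con 0) :+ N := con 2 :* N :* L :+ N) refl N L)
              (solve 2 (λ N L → con 1 :* (con 2 :* con 1 :* N :* L :+ con 1 :* con 0 :* L :+ con 2 :* con 0 :* N :* con 0) := con 2 :* N :* L :+ con 0) refl N L)
              failing)

  all-too-expensive-impossible : ∀ {m r} {bs : Fin m → Bits k} (q : Quotient bs (suc r)) →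
    1 ≤ outsideCount q → ¬ Cosets.AllTooExpensive q
  all-too-expensive-impossible {r = zero} = all-too-expensive-impossible-zero
  all-too-expensive-impossible {r = suc s} = all-too-expensive-impossible-suc

  -- Adjoining any vector outside the span costs nothing here; surjectivity of π supplies one.
  Err-all-inside : ∀ {m r} {bs : Fin m → Bits k} (q : Quotient bs (suc r)) → ErrBound r → outsideCount q ≡ 0 →
    ErrR (suc r) bs ≤ OPT + kernelCost q
  Err-all-inside {m} {r} {bs} q IH NY≡0 with Quotient.π-surjective q (λ _ → true)
  ... | c , πc≗ones with allBits-complete k c
  ...   | b , b∈ , b≗c = *-cancelˡ-≤ (2 * lamDen r) (≤-trans (Err-extension q b∈ zero (πb≗ones zero) IH)
                                                         (≤-reflexive (trans (cong (2 * lamDen r * (OPT + kernelCost q) +_) cost≡0) (+-identityʳ _))))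
    where
      open Quotient q
      open +-*-Solver
      instance
        2D≢0 : NonZero (2 * lamDen r)
        2D≢0 = >-nonZero (≤-trans (lamDen-pos r) (m≤m+n (lamDen r) _))
      πb≗ones : π b ≗ (λ _ → true)
      πb≗ones i = trans (π-cong b≗c i) (πc≗ones i)
      inside : ∀ j → outside q j ≡ false
      inside j with outside q j in e | sumFin≡0⇒≡0 n (b2n ∘ outside q) NY≡0 j
      ... | false | _ = refl
      not-in-coset : ∀ j → inCoset q b j ≡ false
      not-in-coset j with inCoset q b j in e
      ... | false = refl
      ... | true with trans (sym (cong not (eqBits-cong {u = zeroBits} (λ _ → refl) (λ i → trans (eqBits⇒≗ (π (code j)) (π b) e i) (πb≗ones i)))))
                            (inside j)
      ...   | ()
      cost≡0 : extensionCost q b (nnDist b) ≡ 0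
      cost≡0 = trans (costFor-cong q x not-in-coset (λ _ → refl))
        (trans (cong₃ (λ a c e → 2 * lamDen r * a + lamDen r * (c * (nnDistSum bs + x)) + 2 * lamNum r * e)
                      (cong₂ (λ u v → u + v * x) (sumFin-zero n) (sumFin-zero n))
                      (trans (sumFin-cong n (λ j → cong (λ o → b2n (o ∧ true)) (inside j))) (sumFin-zero n))
                      (trans (sumFin-cong n (λ j → cong (λ o → b2n (o ∧ true) * loss j) (inside j))) (sumFin-zero n)))
               (solve 3 (λ D Λ y → con 2 :* D :* con 0 :+ D :* (con 0 :* y) :+ con 2 :* Λ :* con 0 := con 0) refl (lamDen r) (lamNum r) (nnDistSum bs + x)))
        where x = nnDist b

  Err-affordable : ∀ {m r} {bs : Fin m → Bits k} (q : Quotient bs (suc r)) → ErrBound r →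
    ∀ j′ → outside q j′ ≡ true → Cosets.D′ q * Cosets.columnCost q j′ ≤ Cosets.budget q →
    2 * lamDen (suc r) * ErrR (suc r) bs ≤ 2 * lamDen (suc r) * (OPT + kernelCost q) + lamDen (suc r) * (outsideCount q * nnDistSum bs)
                                          + 2 * lamNum (suc r) * outsideLoss q
  Err-affordable {m} {r} {bs} q IH j′ outside-j′ affordable with allBits-complete k (code j′)
  ... | b , b∈ , b≗code = *-cancelˡ-≤ D scaled
    where
      open Quotient q
      open Cosets q
      open +-*-Solver
      instance
        D≢0 : NonZero D
        D≢0 = >-nonZero (lamDen-pos r)
      p = proj₁ (isZero≡false⇒∃true (π (code j′)) (not-injective outside-j′))
      πb-p : π b p ≡ true
      πb-p = trans (π-cong b≗code p) (proj₂ (isZero≡false⇒∃true (π (code j′)) (not-injective outside-j′)))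
      cost≤ : extensionCost q b (nnDist b) ≤ columnCost j′
      cost≤ = ≤-trans (costFor-mono q _ _ (nnDist≤loss j′ b≗code))
                      (≤-reflexive (costFor-cong q (loss j′) (λ j → eqBits-cong {u = π (code j)} (λ _ → refl) (π-cong b≗code))
                                                             (λ j → coordCost-cong q (λ t → cong (code j t xor_) (b≗code t)))))
      X = ErrR (suc r) bs
      P = OPT + kernelCost q
      scaled : D * (2 * D′ * X) ≤ D * (2 * D′ * P + D′ * (NY * E) + 2 * Λ′ * LY)
      scaled =
        begin
          D * (2 * D′ * X)
        ≡⟨ solve 3 (λ D D′ X → D :* (con 2 :* D′ :* X) := D′ :* (con 2 :* D :* X)) refl D D′ X ⟩
          D′ * (2 * D * X)
        ≤⟨ *-monoʳ-≤ D′ (≤-trans (Err-extension q b∈ p πb-p IH) (+-monoʳ-≤ (2 * D * P) cost≤)) ⟩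
          D′ * (2 * D * P + columnCost j′)
        ≤⟨ ≤-trans (≤-reflexive (*-distribˡ-+ D′ (2 * D * P) (columnCost j′))) (+-monoʳ-≤ (D′ * (2 * D * P)) affordable) ⟩
          D′ * (2 * D * P) + budget
        ≡⟨ solve 7 (λ D D′ P NY E Λ′ LY → D′ :* (con 2 :* D :* P) :+ D :* (D′ :* (NY :* E) :+ con 2 :* Λ′ :* LY)
                     := D :* (con 2 :* D′ :* P :+ D′ :* (NY :* E) :+ con 2 :* Λ′ :* LY)) refl D D′ P NY E Λ′ LY ⟩
          D * (2 * D′ * P + D′ * (NY * E) + 2 * Λ′ * LY)
        ∎
        where open ≤-Reasoning

  ErrBound-suc : ∀ r → ErrBound r → ErrBound (suc r)
  ErrBound-suc r IH q with outsideCount q ≟ 0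
  ... | yes NY≡0 = ≤-trans (*-monoʳ-≤ (2 * lamDen (suc r)) (Err-all-inside q IH NY≡0)) (≤-trans (m≤m+n _ _) (m≤m+n _ _))
  ... | no NY≢0 with any? (λ j′ → (outside q j′ ≟ᵇ true) ×-dec (Cosets.D′ q * Cosets.columnCost q j′ ≤? Cosets.budget q))
  ...   | yes (j′ , outside-j′ , affordable) = Err-affordable q IH j′ outside-j′ affordable
  ...   | no none = ⊥-elim (all-too-expensive-impossible q (n≢0⇒n>0 NY≢0)
                              (λ j′ outside-j′ → ≰⇒> (λ affordable → none (j′ , outside-j′ , affordable))))

  ErrBound-all : ∀ r → ErrBound r
  ErrBound-all zero = ErrBound-zero
  ErrBound-all (suc r) = ErrBound-suc r (ErrBound-all r)

  sumL-codes : (X : Bits k → Bool) (W : Fin n → Bits k → ℕ) → (∀ {c c′} → c ≗ c′ → X c ≡ X c′) → (∀ j {c c′} → c ≗ c′ → W j c ≡ W j c′) →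
    sumL (λ c → if X c then sumFin n (λ j → if eqBits (code j) c then W j c else 0) else 0) (allBits k) ≡ sumFin n (λ j → b2n (X (code j)) * W j (code j))
  sumL-codes X W X-cong W-cong =
    trans (sumL-cong (allBits k) per-code)
      (trans (sumL-sumFin n _ (allBits k))
        (sumFin-cong n (λ j → sumL-allBits-point k (code j) (λ c → b2n (X c) * W j c) (λ eq → cong₂ (λ x y → b2n x * y) (X-cong eq) (W-cong j eq)))))
    where
      per-code : ∀ c → (if X c then sumFin n (λ j → if eqBits (code j) c then W j c else 0) else 0)
                       ≡ sumFin n (λ j → if eqBits (code j) c then b2n (X c) * W j c else 0)
      per-code c with X c
      ... | true = sumFin-cong n (λ j → cong (λ z → if eqBits (code j) c then z else 0) (sym (+-identityʳ _)))
      ... | false = sym (trans (sumFin-cong n (λ j → if-same (eqBits (code j) c))) (sumFin-zero n))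
        where if-same : ∀ b → (if b then 0 else 0) ≡ 0
              if-same true = refl
              if-same false = refl

  NX≡ : (X : Bits k → Bool) → (∀ {c c′} → c ≗ c′ → X c ≡ X c′) → NX X ≡ sumFin n (λ j → b2n (X (code j)))
  NX≡ X X-cong = trans (sumL-cong (allBits k) (λ c → cong (λ z → if X c then z else 0) (sumFin-cong n (λ j → b2n≡if (eqBits (code j) c)))))
                   (trans (sumL-codes X (λ _ _ → 1) X-cong (λ _ _ → refl)) (sumFin-cong n (λ j → *-identityʳ _)))
    where b2n≡if : ∀ b → b2n b ≡ (if b then 1 else 0)
          b2n≡if true = refl
          b2n≡if false = refl

  sumLcOutside≡ : ∀ {s} (pre : Fin s → Bits k) → sumLcOutside pre ≡ sumFin n (λ j → b2n (not (inSpan pre (code j))) * loss j)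
  sumLcOutside≡ pre = sumL-codes (λ c → not (inSpan pre c)) (λ j c → wt (a j ⊕ (U ·v c)))
    (cong not ∘ inSpan-cong pre) (λ j eq → wt-cong (λ i → cong (a j i xor_) (·v-cong U eq i)))

  -- The nearest column is at least as close as the average of the columns with code c.
  nnDist≤Mc : ∀ c → toℚ (nnDist c) ≤ℚ Mc c
  nnDist≤Mc c with nc c in nc≡
  ... | zero = toℚ-mono (wt≤length (a (nn (U ·v c)) ⊕ (U ·v c)))
  ... | suc m = toℚ≤/ (nnDist c) (Lc c) m (subst (λ z → nnDist c * z ≤ Lc c) nc≡ nc*nnDist≤Lc)
    where
      nc*nnDist≤Lc : nnDist c * nc c ≤ Lc c
      nc*nnDist≤Lc = ≤-trans (≤-reflexive (sym (sumFin-*ˡ n (nnDist c) _))) (sumFin-mono n (λ j → per-column (eqBits (col V j) c) (nnDist≤ c j)))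
        where per-column : ∀ b {x y} → x ≤ y → x * b2n b ≤ (if b then y else 0)
              per-column true {x} x≤y = ≤-trans (≤-reflexive (*-identityʳ x)) x≤y
              per-column false {x} _ = ≤-reflexive (*-zeroʳ x)

  module _ {s r} {pre : Fin s → Bits k} (q : Quotient pre r) where
    open Quotient q

    kernelWeight : Fin s → ℕ
    kernelWeight i = sumFin n (λ j → b2n (isZero (π (code j))) * b2n (φ (code j) i))

    kernelCost≡ : kernelCost q ≡ sumFin s (λ i → kernelWeight i * nnDist (pre i))
    kernelCost≡ = trans (sumFin-cong n (λ j → sym (sumFin-*ˡ s (b2n (isZero (π (code j)))) _)))
      (trans (sumFin-swap n s _)
        (sumFin-cong s (λ i → trans (sumFin-cong n (λ j → sym (*-assoc (b2n (isZero (π (code j)))) (b2n (φ (code j) i)) (nnDist (pre i)))))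
                            (trans (sumFin-cong n (λ j → *-comm _ (nnDist (pre i)))) (trans (sumFin-*ˡ n (nnDist (pre i)) _) (*-comm (nnDist (pre i)) _))))))

  -- A kernel column with φ-coordinate i equal to 1 lies in b_i + span of the other b's.
  kernelWeight≤NX : ∀ {s r} {pre : Fin s → Bits k} (q : Quotient pre r) i → kernelWeight q i ≤ NX (λ c → inSpanWithout pre i (c ⊕ pre i))
  kernelWeight≤NX {suc s} {pre = pre} q i =
    subst (kernelWeight q i ≤_) (sym (NX≡ _ (λ eq → inSpan-cong others (λ t → cong (_xor pre i t) (eq t))))) (sumFin-mono n per-column)
    where
      open Quotient q
      others : Fin s → Bits k
      others = pre ∘ punchIn i
      x⊕y≡z⇒y≡z⊕x : ∀ {x y z} → x xor y ≡ z → y ≡ z xor x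
      x⊕y≡z⇒y≡z⊕x {true} {true} refl = refl
      x⊕y≡z⇒y≡z⊕x {true} {false} refl = refl
      x⊕y≡z⇒y≡z⊕x {false} {y} refl = sym (xor-identityʳ y)
      per-column : ∀ j → b2n (isZero (π (code j))) * b2n (φ (code j) i) ≤ b2n (inSpanWithout pre i (code j ⊕ pre i))
      per-column j with isZero (π (code j)) in πj≡0 | φ (code j) i in φji≡1
      ... | false | _ = z≤n
      ... | true | false = z≤n
      ... | true | true = ≤-reflexive (cong b2n (sym (inSpan-complete others (φ (code j) ∘ punchIn i) represents)))
        where
          represents : lincomb others (φ (code j) ∘ punchIn i) ≗ (code j ⊕ pre i)
          represents t = x⊕y≡z⇒y≡z⊕x (trans (cong (_xor lincomb others (φ (code j) ∘ punchIn i) t) (sym (cong (_∧ pre i t) φji≡1)))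
                           (trans (sym (xorSum-punchIn s i (λ l → φ (code j) l ∧ pre l t)))
                                  (φ-coordinates (code j) (λ u → sym (eqBits⇒≗ zeroBits (π (code j)) πj≡0 u)) t)))

  outside≤∉span : ∀ {s r} {pre : Fin s → Bits k} (q : Quotient pre r) j → b2n (outside q j) ≤ b2n (not (inSpan pre (code j)))
  outside≤∉span {pre = pre} q j with inSpan pre (code j) in in-span
  ... | false = b2n≤1 _
  ... | true with inSpan-sound pre in-span
  ...   | x , represents = subst (λ z → b2n (not z) ≤ 0) (sym in-kernel) z≤n
    where
      open Quotient q
      in-kernel : isZero (π (code j)) ≡ true
      in-kernel = ≗⇒eqBits zeroBits (π (code j))
        (λ t → sym (trans (π-cong (λ t′ → sym (represents t′)) t) (linear-kills-span π-linear π-cong pre π-kills x t)))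

  outsideCount≤NX : ∀ {s r} {pre : Fin s → Bits k} (q : Quotient pre r) → outsideCount q ≤ NX (λ c → not (inSpan pre c))
  outsideCount≤NX {pre = pre} q = subst (outsideCount q ≤_) (sym (NX≡ _ (cong not ∘ inSpan-cong pre))) (sumFin-mono n (outside≤∉span q))

  outsideLoss≤sumLcOutside : ∀ {s r} {pre : Fin s → Bits k} (q : Quotient pre r) → outsideLoss q ≤ sumLcOutside pre
  outsideLoss≤sumLcOutside {pre = pre} q =
    subst (outsideLoss q ≤_) (sym (sumLcOutside≡ pre)) (sumFin-mono n (λ j → *-monoˡ-≤ (loss j) (outside≤∉span q j)))

  lam-nonNeg : ∀ r → NonNegative (lam r)
  lam-nonNeg r = nonNegative (ℚP.*-cancelˡ-≤-pos (toℚ (lamDen r)) {{positive (ℚP.<-≤-trans (ℚP.positive⁻¹ 1ℚ) (toℚ-mono (lamDen-pos r)))}}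
    (ℚP.≤-trans (ℚP.≤-reflexive (ℚP.*-zeroʳ (toℚ (lamDen r)))) (ℚP.≤-trans (toℚ-mono (z≤n {lamNum r})) (ℚP.≤-reflexive (sym (lamDen*lam≡lamNum r))))))

  ErrR≤ℚ : ∀ r {s} {pre : Fin s → Bits k} (q : Quotient pre r) →
    toℚ (ErrR r pre) ≤ℚ toℚ OPT +ℚ toℚ (kernelCost q) +ℚ ½ *ℚ (toℚ (outsideCount q) *ℚ toℚ (nnDistSum pre)) +ℚ lam r *ℚ toℚ (outsideLoss q)
  ErrR≤ℚ r {pre = pre} q = ℚP.*-cancelˡ-≤-pos (toℚ 2 *ℚ toℚ D) {{positive 2D>0}} (subst₂ _≤ℚ_ (⟦⟧ℚ-homo lhs) (trans (⟦⟧ℚ-homo rhs) rhs≡)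
                                                                          (toℚ-mono (ErrBound-all r q)))
    where
      D = lamDen r
      lhs = ‵ 2 ⊠ ‵ D ⊠ ‵ ErrR r pre
      rhs = ‵ 2 ⊠ ‵ D ⊠ (‵ OPT ⊞ ‵ kernelCost q) ⊞ ‵ D ⊠ (‵ outsideCount q ⊠ ‵ nnDistSum pre) ⊞ ‵ 2 ⊠ ‵ lamNum r ⊠ ‵ outsideLoss q
      2D>0 : 0ℚ <ℚ toℚ 2 *ℚ toℚ D
      2D>0 = ℚP.<-≤-trans (ℚP.positive⁻¹ 1ℚ) (ℚP.≤-trans (toℚ-mono (≤-trans (lamDen-pos r) (m≤m+n D (D + 0)))) (ℚP.≤-reflexive (toℚ-* 2 D)))
      rhs≡ : ⟦ rhs ⟧ℚ ≡ (toℚ 2 *ℚ toℚ D) *ℚ (toℚ OPT +ℚ toℚ (kernelCost q) +ℚ ½ *ℚ (toℚ (outsideCount q) *ℚ toℚ (nnDistSum pre)) +ℚ lam r *ℚ toℚ (outsideLoss q))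
      rhs≡ = trans (cong (λ z → toℚ 2 *ℚ toℚ D *ℚ (toℚ OPT +ℚ toℚ (kernelCost q)) +ℚ toℚ D *ℚ (toℚ (outsideCount q) *ℚ toℚ (nnDistSum pre))
                              +ℚ toℚ 2 *ℚ z *ℚ toℚ (outsideLoss q)) (sym (lamDen*lam≡lamNum r)))
        (solve 7 (λ d o k ny e l ly → con (toℚ 2) :* d :* (o :+ k) :+ d :* (ny :* e) :+ con (toℚ 2) :* (d :* l) :* ly
                                     := (con (toℚ 2) :* d) :* (o :+ k :+ con ½ :* (ny :* e) :+ l :* ly))
               refl (toℚ D) (toℚ OPT) (toℚ (kernelCost q)) (toℚ (outsideCount q)) (toℚ (nnDistSum pre)) (lam r) (toℚ (outsideLoss q)))
        where open ℚ-Solver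

  kernel+outside≤Σf*M : ∀ {s r} {pre : Fin s → Bits k} (q : Quotient pre r) →
    toℚ (kernelCost q) +ℚ ½ *ℚ (toℚ (outsideCount q) *ℚ toℚ (nnDistSum pre)) ≤ℚ sumFinℚ s (λ i → f pre i *ℚ Mc (pre i))
  kernel+outside≤Σf*M {s} {pre = pre} q = ℚP.≤-trans (ℚP.≤-reflexive as-sum) (sumFinℚ-mono s per-vector)
    where
      NY = toℚ (outsideCount q)
      e : Fin s → ℚ
      e i = toℚ (nnDist (pre i))
      instance
        ½-nonNeg : NonNegative ½
        ½-nonNeg = nonNegative (ℚP.<⇒≤ (ℚP.positive⁻¹ ½))
      as-sum : toℚ (kernelCost q) +ℚ ½ *ℚ (NY *ℚ toℚ (nnDistSum pre)) ≡ sumFinℚ s (λ i → (toℚ (kernelWeight q i) +ℚ ½ *ℚ NY) *ℚ e i)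
      as-sum = trans (cong₂ (λ u v → u +ℚ ½ *ℚ (NY *ℚ v))
                       (trans (cong toℚ (kernelCost≡ q)) (trans (toℚ-sumFin s _) (sumFinℚ-cong s (λ i → toℚ-* (kernelWeight q i) (nnDist (pre i))))))
                       (toℚ-sumFin s (nnDist ∘ pre)))
                 (trans (cong (sumFinℚ s (λ i → toℚ (kernelWeight q i) *ℚ e i) +ℚ_) (sym (ℚP.*-assoc ½ NY _)))
                   (sumFinℚ-*-+ s (toℚ ∘ kernelWeight q) e (½ *ℚ NY)))
      f-nonNeg : ∀ i → NonNegative (f pre i)
      f-nonNeg i = nonNegative (ℚP.≤-trans (ℚP.≤-reflexive (sym (trans (ℚP.+-identityˡ (½ *ℚ 0ℚ)) (ℚP.*-zeroʳ ½))))
                     (ℚP.+-mono-≤ (toℚ-mono (z≤n {NX (λ c → inSpanWithout pre i (c ⊕ pre i))})) (ℚP.*-monoˡ-≤-nonNeg ½ (toℚ-mono (z≤n {NX (λ c → not (inSpan pre c))})))))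
      per-vector : ∀ i → (toℚ (kernelWeight q i) +ℚ ½ *ℚ NY) *ℚ e i ≤ℚ f pre i *ℚ Mc (pre i)
      per-vector i = *-mono-≤-nonNeg {{toℚ-nonNeg (nnDist (pre i))}} {{f-nonNeg i}}
                       (ℚP.+-mono-≤ (toℚ-mono (kernelWeight≤NX q i)) (ℚP.*-monoˡ-≤-nonNeg ½ (toℚ-mono (outsideCount≤NX q))))
                       (nnDist≤Mc (pre i))

  Err≤RHS : ∀ r {s} {pre : Fin s → Bits k} (q : Quotient pre r) → toℚ (ErrR r pre) ≤ℚ RHS r pre
  Err≤RHS r {s} {pre} q =
    begin
      toℚ (ErrR r pre)
    ≤⟨ ErrR≤ℚ r q ⟩
      o +ℚ toℚ (kernelCost q) +ℚ ½ *ℚ (toℚ (outsideCount q) *ℚ toℚ (nnDistSum pre)) +ℚ lam r *ℚ toℚ (outsideLoss q)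
    ≡⟨ cong (_+ℚ lam r *ℚ toℚ (outsideLoss q)) (ℚP.+-assoc o _ _) ⟩
      o +ℚ (toℚ (kernelCost q) +ℚ ½ *ℚ (toℚ (outsideCount q) *ℚ toℚ (nnDistSum pre))) +ℚ lam r *ℚ toℚ (outsideLoss q)
    ≤⟨ ℚP.+-mono-≤ (ℚP.+-monoʳ-≤ o (kernel+outside≤Σf*M q)) (ℚP.*-monoˡ-≤-nonNeg (lam r) {{lam-nonNeg r}} (toℚ-mono (outsideLoss≤sumLcOutside q))) ⟩
      o +ℚ F +ℚ lam r *ℚ L
    ≡⟨ solve 4 (λ o F l L → (o :+ F) :+ l :* L := o :+ l :* L :+ F) refl o F (lam r) L ⟩
      RHS r pre
    ∎
    where
      open ℚP.≤-Reasoning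
      open ℚ-Solver
      o = toℚ OPT
      F = sumFinℚ s (λ i → f pre i *ℚ Mc (pre i))
      L = toℚ (sumLcOutside pre)

theorem3 : (d n k : ℕ) → 1 ≤ k → (A : Mat d n) (U : Mat d k) (V : Mat k n)
  → ((U′ : Mat d k) (V′ : Mat k n) → wtM (A ⊕M (U · V)) ≤ wtM (A ⊕M (U′ · V′)))
  → (nn : Bits d → Fin n) → ((u : Bits d) (j : Fin n) → wt (col A (nn u) ⊕ u) ≤ wt (col A j ⊕ u))
  → (bs : Fin k → Bits k) → LinIndep bs
  → (r : ℕ) → r ≤ k
  → let open Setup d n k A U V nn
        pre : Fin (k ∸ r) → Bits k
        pre i = bs (inject≤ i (m∸n≤m k r))
    in toℚ (ErrR r pre) ≤ℚ RHS r pre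
theorem3 d n k _ A U V _ nn nn-nearest bs independent r r≤k =
  Err≤RHS r (quotient-of-independent (k ∸ r) r (m∸n+n≡m r≤k) _ (LinIndep-inject≤ bs (m∸n≤m k r) independent))
  where open Bounds d n k A U V nn nn-nearest
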